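{- $\mathsf{IGMP}(\omega_2)$ implies that there does not exist an $\omega_1$-Suslin tree, so the Suslin hypothesis holds.
   Context: $H(\omega_2)$ is the collection of sets of hereditary cardinality less than $\omega_2$, and $P_{\omega_2}(X)=\{a\subseteq X: |a|<\omega_2\}$. For a set $N$, a set $d\subseteq N$ is countably approximated by $N$ if for every $a\in N$ which $N$ models is countable, $d\cap a\in N$. A set $d\subseteq N$ is $N$-guessed if there is $e\in N$ with $d=e\cap N$. $N$ is $\omega_1$-guessing if every $d\subseteq N\cap \mathrm{On}$ with $\sup(d)<\sup(N\cap\mathrm{On})$ which is countably approximated by $N$ is $N$-guessed. $N$ is indestructibly $\omega_1$-guessing if every forcing poset which preserves $\omega_1$ forces that $N$ is $\omega_1$-guessing. $\mathsf{IGMP}(\omega_2)$ says that there are stationarily many $N\in P_{\omega_2}(H(\omega_2))$ which are indestructibly $\omega_1$-guessing. -}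

module Defs where

open import Data.Bool using (Bool; T)
open import Data.Nat using (ℕ)
open import Data.Product using (Σ; Σ-syntax; ∃; ∃-syntax; _×_; _,_; proj₁; proj₂)
open import Data.Product.Relation.Binary.Pointwise.NonDependent using (×-setoid)
open import Data.Sum using (_⊎_; [_,_]′)
open import Data.Empty.Polymorphic using (⊥)
open import Function.Bundles using (Injection)
open import Induction.WellFounded using (Acc; acc; WellFounded)
open import Level using (Lift; 0ℓ) renaming (suc to lsuc)
open import Relation.Binary.Bundles using (Setoid; Poset; StrictPartialOrder; StrictTotalOrder)
open import Relation.Binary.Core using (Rel)
open import Relation.Binary.Definitions using (Transitive; _Respects_)
import Relation.Binary.Construct.On as On
open import Relation.Binary.PropositionalEquality using (setoid)
open import Relation.Nullary using (¬_)
open import Relation.Unary using (Pred)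

------------------------------------------------------------------------
-- The universe of sets

-- Aczel's cumulative hierarchy over Set, with extensional equality _≈_.
-- Under excluded middle and function extensionality (which together give
-- the axiom of choice) it satisfies ZFC.  Structures that are not used as
-- elements of other sets (forcing posets, trees, linear orders) are taken
-- to be small setoids.

data V : Set₁ where
  sup : (A : Set) → (A → V) → V

infix 4 _≈_ _∈_ _⊆_

_≈_ : V → V → Set
sup A f ≈ sup B g =
  (∀ a → ∃[ b ] f a ≈ g b) × (∀ b → ∃[ a ] f a ≈ g b)

≈-refl : ∀ {x} → x ≈ x
≈-refl {sup A f} = (λ a → a , ≈-refl) , (λ a → a , ≈-refl)

≈-sym : ∀ {x y} → x ≈ y → y ≈ x
≈-sym {sup A f} {sup B g} (l , r) =
  (λ b → proj₁ (r b) , ≈-sym (proj₂ (r b))) ,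
  (λ a → proj₁ (l a) , ≈-sym (proj₂ (l a)))

≈-trans : ∀ {x y z} → x ≈ y → y ≈ z → x ≈ z
≈-trans {sup A f} {sup B g} {sup C h} (l , r) (l′ , r′) =
  (λ a → let b , p = l a ; c , q = l′ b in c , ≈-trans p q) ,
  (λ c → let b , q = r′ c ; a , p = r b in a , ≈-trans p q)

V-setoid : Setoid (lsuc 0ℓ) 0ℓ
V-setoid = record
  { Carrier = V
  ; _≈_ = _≈_
  ; isEquivalence = record
    { refl = ≈-refl
    ; sym = λ {x} {y} → ≈-sym {x} {y}
    ; trans = λ {x} {y} {z} → ≈-trans {x} {y} {z}
    }
  }

Index : V → Set
Index (sup A f) = A

element : (x : V) → Index x → V
element (sup A f) = f

_∈_ : V → V → Set
x ∈ y = ∃[ j ] x ≈ element y j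

_⊆_ : V → V → Set₁
x ⊆ y = ∀ {z} → z ∈ x → z ∈ y

⋃ : V → V
⋃ x = sup (Σ[ i ∈ Index x ] Index (element x i))
          (λ (i , j) → element (element x i) j)

-- trcl x = x ∪ ⋃ { trcl y | y ∈ x }
trcl : V → V
trcl (sup A f) = sup (A ⊎ (Σ[ a ∈ A ] Index (trcl (f a))))
                     [ f , (λ (a , i) → element (trcl (f a)) i) ]′

Elements : V → Setoid 0ℓ 0ℓ
Elements x = record
  { Carrier = Index x
  ; _≈_ = λ i j → element x i ≈ element x j
  ; isEquivalence = On.isEquivalence (element x) (Setoid.isEquivalence V-setoid)
  }

-- On a transitive well-founded relation that is linear below a, the
-- collapse of a is the order type of the predecessors of a, as a von
-- Neumann ordinal.
collapse : {A : Set} {_<_ : Rel A 0ℓ} (a : A) → Acc _<_ a → V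
collapse {A} {_<_} a (acc rs) =
  sup (Σ[ b ∈ A ] b < a) (λ (b , b<a) → collapse b (rs b<a))

-- The collapses of the points of a transitive well-founded relation are
-- ordinals, and every countable ordinal is the collapse of 0 for some such
-- relation on ℕ.
ω₁ : V
ω₁ = sup (Σ[ R ∈ (ℕ → ℕ → Bool) ]
            Transitive (λ m n → T (R m n)) × WellFounded (λ m n → T (R m n)))
         (λ (R , _ , wf) → collapse 0 (wf 0))

------------------------------------------------------------------------
-- Cardinality, H(ω₂) and stationary subsets of P_ω₂(H(ω₂))

Countable : Setoid 0ℓ 0ℓ → Set
Countable S = Injection S (setoid ℕ)

Subsetoid : (S : Setoid 0ℓ 0ℓ) → Pred (Setoid.Carrier S) 0ℓ → Setoid 0ℓ 0ℓ
Subsetoid S P = On.setoid S (proj₁ {B = P})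

-- |x| < ω₂ , that is, |x| ≤ ω₁
∣_∣<ω₂ : V → Set
∣ x ∣<ω₂ = Injection (Elements x) (Elements ω₁)

H⟨ω₂⟩ : V → Set
H⟨ω₂⟩ x = ∣ trcl x ∣<ω₂

P-ω₂⟨H⟨ω₂⟩⟩ : V → Set₁
P-ω₂⟨H⟨ω₂⟩⟩ a = (∀ {x} → x ∈ a → H⟨ω₂⟩ x) × ∣ a ∣<ω₂

record Club (C : V → Set) : Set₁ where
  field
    resp      : C Respects _≈_
    subset    : ∀ {a} → C a → P-ω₂⟨H⟨ω₂⟩⟩ a
    unbounded : ∀ {a} → P-ω₂⟨H⟨ω₂⟩⟩ a → ∃[ b ] C b × a ⊆ b
    closed    : ∀ (D : V) → ∣ D ∣<ω₂ → (∃[ a ] a ∈ D) → (∀ {a} → a ∈ D → C a) →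
                (∀ {a b} → a ∈ D → b ∈ D → a ⊆ b ⊎ b ⊆ a) → C (⋃ D)

StationarilyMany : (V → Set₁) → Set₁
StationarilyMany S = ∀ (C : V → Set) → Club C → ∃[ N ] C N × S N

------------------------------------------------------------------------
-- The first-order language of set theory

-- Formulas are written once, for an arbitrary interpretation of the
-- primitive symbols, so that the same formula can be read in a forcing
-- extension and relativised to a set.

record Interpretation : Set₃ where
  infix  7 _ε_ _≐_
  infixr 6 _∧_
  infixr 4 _⇒_
  field
    Dom : Set₁
    Ω   : Set₂
    _ε_ : Dom → Dom → Ω
    _≐_ : Dom → Dom → Ω
    ff  : Ω
    _∧_ : Ω → Ω → Ω
    _⇒_ : Ω → Ω → Ω
    All : (Dom → Ω) → Ω

-- Bounding all quantifiers by N: the formula φ read in _↾_ I N is "N ⊨ φ".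
_↾_ : (I : Interpretation) → Interpretation.Dom I → Interpretation
I ↾ N = record I { All = λ φ → I.All (λ x → (x I.ε N) I.⇒ φ x) }
  where module I = Interpretation I

module Formulas (I : Interpretation) where
  open Interpretation I public

  infixr 5 _∨_
  infix  3 _⇔_
  infix  8 ~_

  ~_ : Ω → Ω
  ~ φ = φ ⇒ ff

  _∨_ : Ω → Ω → Ω
  φ ∨ ψ = ~ (~ φ ∧ ~ ψ)

  _⇔_ : Ω → Ω → Ω
  φ ⇔ ψ = (φ ⇒ ψ) ∧ (ψ ⇒ φ)

  Ex : (Dom → Ω) → Ω
  Ex φ = ~ All (λ x → ~ φ x)

  infix 2 All-syntax Ex-syntax All∈-syntax Ex∈-syntax

  All-syntax Ex-syntax : (Dom → Ω) → Ω
  All-syntax = All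
  Ex-syntax  = Ex

  All∈-syntax Ex∈-syntax : Dom → (Dom → Ω) → Ω
  All∈-syntax a φ = All (λ x → x ε a ⇒ φ x)
  Ex∈-syntax  a φ = Ex  (λ x → x ε a ∧ φ x)

  syntax All-syntax (λ x → φ)    = all[ x ] φ
  syntax Ex-syntax (λ x → φ)     = ex[ x ] φ
  syntax All∈-syntax a (λ x → φ) = all[ x ε a ] φ
  syntax Ex∈-syntax a (λ x → φ)  = ex[ x ε a ] φ

  isPair : Dom → Dom → Dom → Ω
  isPair z x y = all[ w ] (w ε z ⇔ w ≐ x ∨ w ≐ y)

  isOrderedPair : Dom → Dom → Dom → Ω
  isOrderedPair z x y =
    ex[ u ] ex[ v ] (isPair u x x ∧ isPair v x y ∧ isPair z u v)

  isIntersection : Dom → Dom → Dom → Ω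
  isIntersection c x y = all[ z ] (z ε c ⇔ z ε x ∧ z ε y)

  isTransitive : Dom → Ω
  isTransitive x = all[ y ε x ] all[ z ε y ] z ε x

  isOrdinal : Dom → Ω
  isOrdinal x = isTransitive x ∧ (all[ y ε x ] isTransitive y)

  isSuccessor : Dom → Dom → Ω
  isSuccessor y x = all[ z ] (z ε y ⇔ z ε x ∨ z ≐ x)

  isLimit : Dom → Ω
  isLimit x = isOrdinal x ∧ (ex[ y ] y ε x) ∧ (all[ y ε x ] ex[ z ε x ] isSuccessor z y)

  isω : Dom → Ω
  isω x = isLimit x ∧ (all[ y ε x ] ~ isLimit y)

  isInjection : Dom → Dom → Dom → Ω
  isInjection f a b =
      (all[ z ε f ] ex[ x ε a ] ex[ y ε b ] isOrderedPair z x y)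
    ∧ (all[ x ε a ] ex[ y ε b ] x ↦ y)
    ∧ (all[ x ] all[ y ] all[ y′ ] (x ↦ y ∧ x ↦ y′ ⇒ y ≐ y′))
    ∧ (all[ x ] all[ x′ ] all[ y ] (x ↦ y ∧ x′ ↦ y ⇒ x ≐ x′))
    where
    infix 7 _↦_
    _↦_ : Dom → Dom → Ω
    x ↦ y = ex[ z ε f ] isOrderedPair z x y

  isCountable : Dom → Ω
  isCountable a = ex[ w ] (isω w ∧ (ex[ f ] isInjection f a w))

  isω₁ : Dom → Ω
  isω₁ x = isOrdinal x ∧ ~ isCountable x ∧ (all[ α ε x ] isCountable α)

  -- s is the supremum of the class A of ordinals
  isSup : Dom → (Dom → Ω) → Ω
  isSup s A = isUpperBound s ∧ (all[ u ] (isUpperBound u ⇒ s ε u ∨ s ≐ u))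
    where
    isUpperBound : Dom → Ω
    isUpperBound u = isOrdinal u ∧ (all[ α ] (A α ⇒ α ε u ∨ α ≐ u))

module Guessing (I : Interpretation) where
  open Formulas I
  private module _⊨ (N : Dom) = Formulas (I ↾ N)

  isCountablyApproximatedBy : Dom → Dom → Ω
  isCountablyApproximatedBy d N =
    all[ a ε N ] (_⊨.isCountable N a ⇒ (ex[ c ε N ] isIntersection c d a))

  isGuessedBy : Dom → Dom → Ω
  isGuessedBy d N = ex[ e ε N ] isIntersection d e N

  isω₁-Guessing : Dom → Ω
  isω₁-Guessing N =
    all[ d ] ( (all[ α ε d ] (α ε N ∧ isOrdinal α))
             ∧ (ex[ s ] ex[ t ] ( isSup s (λ α → α ε d)
                                ∧ isSup t (λ α → α ε N ∧ isOrdinal α)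
                                ∧ s ε t ))
             ∧ isCountablyApproximatedBy d N
             ⇒ isGuessedBy d N )

------------------------------------------------------------------------
-- Forcing

module Forcing (P : Poset 0ℓ 0ℓ 0ℓ) where
  open Poset P using (_≤_) renaming (Carrier to Cond)

  -- name I τ c is the P-name { (τ i , c i) | i : I }.
  data Name : Set₁ where
    name : (I : Set) → (I → Name) → (I → Cond) → Name

  -- P need not have a greatest element, so x̌ = { (y̌ , p) | y ∈ x , p ∈ P }.
  check : V → Name
  check (sup A f) = name (A × Cond) (λ (a , _) → check (f a)) proj₂

  forces-≐ : Name → Name → Cond → Set
  forces-≐ (name I σ c) (name J τ d) p =
      (∀ i q → q ≤ p → q ≤ c i → ∃[ r ] r ≤ q × (∃[ j ] r ≤ d j × forces-≐ (σ i) (τ j) r))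
    × (∀ j q → q ≤ p → q ≤ d j → ∃[ r ] r ≤ q × (∃[ i ] r ≤ c i × forces-≐ (σ i) (τ j) r))

  forces-ε : Name → Name → Cond → Set
  forces-ε σ (name J τ d) p =
    ∀ q → q ≤ p → ∃[ r ] r ≤ q × (∃[ j ] r ≤ d j × forces-≐ σ (τ j) r)

  -- The forcing relation.  Disjunction and existence are the classical
  -- abbreviations, so every formula is forced at p as soon as it is forced
  -- densely below p.
  forcing : Interpretation
  forcing = record
    { Dom = Name
    ; Ω   = Cond → Set₁
    ; _ε_ = λ σ τ p → Lift _ (forces-ε σ τ p)
    ; _≐_ = λ σ τ p → Lift _ (forces-≐ σ τ p)
    ; ff  = λ p → ⊥
    ; _∧_ = λ φ ψ p → φ p × ψ p
    ; _⇒_ = λ φ ψ p → ∀ q → q ≤ p → φ q → ψ q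
    ; All = λ φ p → ∀ σ → φ σ p
    }

  open Formulas forcing using (isω₁)
  open Guessing forcing using (isω₁-Guessing)

  Preserves-ω₁ : Set₁
  Preserves-ω₁ = ∀ p → isω₁ (check ω₁) p

  Forces-ω₁-Guessing : V → Set₁
  Forces-ω₁-Guessing N = ∀ p → isω₁-Guessing (check N) p

IndestructiblyGuessing : V → Set₁
IndestructiblyGuessing N =
  ∀ (P : Poset 0ℓ 0ℓ 0ℓ) → Forcing.Preserves-ω₁ P → Forcing.Forces-ω₁-Guessing P N

IGMP⟨ω₂⟩ : Set₁
IGMP⟨ω₂⟩ = StationarilyMany (λ N → P-ω₂⟨H⟨ω₂⟩⟩ N × IndestructiblyGuessing N)

------------------------------------------------------------------------
-- Suslin trees and Suslin lines

record Tree : Set₁ where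
  field
    order : StrictPartialOrder 0ℓ 0ℓ 0ℓ
  open StrictPartialOrder order public renaming (_≈_ to _≈ᵗ_)
  field
    wellFounded        : WellFounded _<_
    predecessorsLinear : ∀ {t x y} → x < t → y < t → x < y ⊎ x ≈ᵗ y ⊎ y < x

  nodes : Setoid 0ℓ 0ℓ
  nodes = record { isEquivalence = isEquivalence }

  ht : Carrier → V
  ht t = collapse t (wellFounded t)

  -- The height is the set of ht t, which is also the least α such that
  -- no node has height α.
  height : V
  height = sup Carrier ht

  IsChain IsAntichain : Pred Carrier 0ℓ → Set
  IsChain S     = ∀ {x y} → S x → S y → x < y ⊎ x ≈ᵗ y ⊎ y < x
  IsAntichain S = ∀ {x y} → S x → S y → ¬ x < y

record Isω₁-Suslin (𝕋 : Tree) : Set₁ where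
  open Tree 𝕋
  field
    height≈ω₁           : height ≈ ω₁
    chainsCountable     : ∀ S → IsChain S → Countable (Subsetoid nodes S)
    antichainsCountable : ∀ S → IsAntichain S → Countable (Subsetoid nodes S)

module _ (L : StrictTotalOrder 0ℓ 0ℓ 0ℓ) where
  open StrictTotalOrder L renaming (_≈_ to _≈ˡ_; module Eq to Eqˡ)

  DenseOrder : Set
  DenseOrder = ∀ {x y} → x < y → ∃[ z ] x < z × z < y

  -- The open interval (a , b) is represented by its pair of endpoints,
  -- which in a dense order are determined by the interval.
  CCC : Set₁
  CCC = ∀ (𝓘 : Pred (Carrier × Carrier) 0ℓ) →
    (∀ {a b} → 𝓘 (a , b) → a < b) →
    (∀ {a b c d x} → 𝓘 (a , b) → 𝓘 (c , d) →
       a < x → x < b → c < x → x < d → a ≈ˡ c × b ≈ˡ d) →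
    Countable (Subsetoid (×-setoid Eqˡ.setoid Eqˡ.setoid) 𝓘)

  Separable : Set₁
  Separable = Σ[ D ∈ Pred Carrier 0ℓ ]
    Countable (Subsetoid Eqˡ.setoid D) ×
    (∀ {a b} → a < b → ∃[ x ] D x × a < x × x < b)

  IsSuslinLine : Set₁
  IsSuslinLine = DenseOrder × CCC × ¬ Separable

SuslinHypothesis : Set₁
SuslinHypothesis = ¬ (∃[ L ] IsSuslinLine L)

{-# OPTIONS --safe #-}
module Submission where

-- A Suslin tree, pruned to the nodes with uncountably many extensions and turned
-- upside down, is a c.c.c. forcing P, so it preserves ω₁.  Code its nodes by
-- countable ordinals.  If N is transitive of size ω₁ and closed under
-- a ↦ a ∩ {codes of the predecessors of t}, then N countably approximates the
-- generic branch: any condition outside the countably many predecessor sets of the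
-- nodes coded in a countable a decides the intersection of the branch with a.  Such
-- N form a club, so by IGMP one of them guesses the branch; then some condition
-- decides it, so the uncountably many nodes above that condition form a chain.
-- From a Suslin line one gets such a tree by recursion on k < ω₁, choosing an
-- interval which avoids the endpoints and midpoints of all earlier intervals.

-- No generic filter is available: the argument stays inside the forcing relation, where
-- existentials and disjunctions hold only densely below a condition. The formula for countability
-- is needed in two readings: over all names, to preserve ω₁, and relativised to `N`, in countable
-- approximation. `Quantifier` covers both, and a single chain condition argument,
-- `isCountable⇒countable`, keeps ω₁ uncountable and also turns "`N` models that a is countable"
-- into true countability, with `N` merely transitive rather than elementary. Guessing concerns only
-- sets of ordinals whose supremum is below that of the ordinals of `N`. The codes on the branch are
-- below ω₁; adding ω₁ to the branch makes its supremum ω₁ at once, with no analysis of how long the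
-- branch is, and `succ ω₁` in `N` puts ω₁ below the supremum of the ordinals of `N`. The sets `E k`
-- carry the same extra point. Pruning leaves uncountably many conditions below each condition. This
-- produces the deciding conditions and also gives the final contradiction.

open import Defs
open import Axiom.ExcludedMiddle using (ExcludedMiddle)
open import Axiom.Extensionality.Propositional using (Extensionality)
open import Axiom.UniquenessOfIdentityProofs.WithK using (uip)
open import Data.Bool using (Bool; true; false; T; if_then_else_)
open import Data.Bool.Properties using (T-irrelevant)
open import Data.Empty using (⊥; ⊥-elim)
open import Data.List using (List; []; _∷_; foldr)
open import Data.Maybe using (Maybe; just; nothing; maybe′)
open import Data.Nat as ℕ using (ℕ; zero; suc)
open import Data.Nat.Induction using (<-wellFounded)
import Data.Nat.Properties as ℕₚ
open import Data.Product using (Σ; Σ-syntax; ∃-syntax; _×_; _,_; proj₁; proj₂)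
import Data.Product.Relation.Binary.Lex.Strict as Lex
open import Data.Product.Relation.Binary.Pointwise.NonDependent using (×-setoid)
open import Data.Sum using (_⊎_; inj₁; inj₂; [_,_]′)
open import Data.Unit using (⊤; tt)
open import Function using (_∘_; id)
open import Function.Bundles using (Injection)
open import Induction.WellFounded as WF using (Acc; acc; WellFounded; wf⇒asym)
open import Level using (Level; 0ℓ; _⊔_; Lift; lift; lower) renaming (suc to lsuc)
open import Relation.Binary.Bundles using (Setoid; Poset; StrictPartialOrder; StrictTotalOrder)
import Relation.Binary.Construct.On as On
import Relation.Binary.Construct.StrictToNonStrict as ToNonStrict
open import Relation.Binary.Core using (Rel)
open import Relation.Binary.Definitions using (Transitive; tri<; tri≈; tri>)
open import Relation.Binary.PropositionalEquality
  using (_≡_; _≢_; refl; sym; trans; cong; cong₂; subst; setoid)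
open import Relation.Binary.Structures using (IsEquivalence; IsPartialOrder)
open import Relation.Nullary using (¬_; Dec; yes; no)
open import Relation.Nullary.Decidable using (does)
open import Relation.Unary using (Pred)

private variable
  a b ℓ ℓ′ : Level

-- _≈_ and _∈_ compute on constructors, which blocks the inference of their
-- arguments; the record wrappers _≅_ and _∊_ do not.

infix 4 _≅_ _∊_

record _≅_ (x y : V) : Set where
  constructor ≈⇒≅
  field ≅⇒≈ : x ≈ y
open _≅_

record _∊_ (x y : V) : Set where
  constructor ∈⇒∊
  field ∊⇒∈ : x ∈ y
open _∊_

≅-refl : ∀ {x} → x ≅ x
≅-refl = ≈⇒≅ ≈-refl

≅-sym : ∀ {x y} → x ≅ y → y ≅ x
≅-sym {x} {y} (≈⇒≅ p) = ≈⇒≅ (≈-sym {x} {y} p)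

≅-trans : ∀ {x y z} → x ≅ y → y ≅ z → x ≅ z
≅-trans {x} {y} {z} (≈⇒≅ p) (≈⇒≅ q) = ≈⇒≅ (≈-trans {x} {y} {z} p q)

∊-element : ∀ x (i : Index x) → element x i ∊ x
∊-element x i = ∈⇒∊ (i , ≈-refl)

index : ∀ {z x} → z ∊ x → Index x
index (∈⇒∊ (i , _)) = i

≅-index : ∀ {z x} (z∊x : z ∊ x) → z ≅ element x (index z∊x)
≅-index (∈⇒∊ (_ , p)) = ≈⇒≅ p

∊-intro : ∀ {z x} (i : Index x) → z ≅ element x i → z ∊ x
∊-intro i (≈⇒≅ p) = ∈⇒∊ (i , p)

∊-respˡ : ∀ {x x′ y} → x ≅ x′ → x ∊ y → x′ ∊ y
∊-respˡ p q = ∊-intro (index q) (≅-trans (≅-sym p) (≅-index q))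

∊-respʳ : ∀ {x y y′} → y ≅ y′ → x ∊ y → x ∊ y′
∊-respʳ {y = sup A f} {sup B g} (≈⇒≅ (l , _)) (∈⇒∊ (i , p)) =
  ∊-intro (proj₁ (l i)) (≅-trans (≈⇒≅ p) (≈⇒≅ (proj₂ (l i))))

≅-ext : ∀ {x y} → (∀ {z} → z ∊ x → z ∊ y) → (∀ {z} → z ∊ y → z ∊ x) → x ≅ y
≅-ext {x@(sup A f)} {y@(sup B g)} l r = ≈⇒≅
  ( (λ a → let h = l (∊-element x a) in index h , ≅⇒≈ (≅-index h))
  , (λ b → let h = r (∊-element y b) in index h , ≅⇒≈ (≅-sym (≅-index h))) )

∊-wellFounded : WellFounded _∊_
∊-wellFounded x = go x ≅-refl
  where
  go : ∀ x {y} → y ≅ x → Acc _∊_ y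
  go x@(sup A f) y≅x = acc λ z∊y →
    let h = ∊-respʳ y≅x z∊y in go (f (index h)) (≅-index h)

∊-asym : ∀ {x y} → x ∊ y → ¬ y ∊ x
∊-asym = wf⇒asym ∊-wellFounded

∊-irrefl : ∀ {x y} → x ≅ y → ¬ x ∊ y
∊-irrefl p x∊y = ∊-asym h h
  where h = ∊-respʳ (≅-sym p) x∊y

∅ : V
∅ = sup ⊥ λ ()

insert : V → V → V
insert y x = sup (Maybe (Index x)) (maybe′ (element x) y)

∊-insert : ∀ y x → y ∊ insert y x
∊-insert y x = ∊-intro nothing ≅-refl

insert⁺ : ∀ {x y z} → z ∊ x → z ∊ insert y x
insert⁺ z∊x = ∊-intro (just (index z∊x)) (≅-index z∊x)

insert⁻ : ∀ {x y z} → z ∊ insert y x → z ∊ x ⊎ z ≅ y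
insert⁻ (∈⇒∊ (just i , p))  = inj₁ (∈⇒∊ (i , p))
insert⁻ (∈⇒∊ (nothing , p)) = inj₂ (≈⇒≅ p)

succ : V → V
succ x = insert x x

∊-succ : ∀ x → x ∊ succ x
∊-succ x = ∊-insert x x

succ⁺ : ∀ {x z} → z ∊ x → z ∊ succ x
succ⁺ = insert⁺

succ⁻ : ∀ {x z} → z ∊ succ x → z ∊ x ⊎ z ≅ x
succ⁻ = insert⁻

infixl 7 _∩_

abstract
  _∩_ : V → V → V
  x ∩ y = sup (Σ[ i ∈ Index x ] element x i ∊ y) (λ (i , _) → element x i)

  ∩⁺ : ∀ {x y z} → z ∊ x → z ∊ y → z ∊ x ∩ y
  ∩⁺ z∊x z∊y = ∊-intro (index z∊x , ∊-respˡ (≅-index z∊x) z∊y) (≅-index z∊x)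

  ∩⁻ : ∀ {x y z} → z ∊ x ∩ y → z ∊ x × z ∊ y
  ∩⁻ (∈⇒∊ ((i , h) , p)) = ∈⇒∊ (i , p) , ∊-respˡ (≅-sym (≈⇒≅ p)) h

∩-cong : ∀ {x x′ y} → x ≅ x′ → x ∩ y ≅ x′ ∩ y
∩-cong {x} {x′} p = ≅-ext
  (λ h → let a , b = ∩⁻ {x} h in ∩⁺ (∊-respʳ p a) b)
  (λ h → let a , b = ∩⁻ {x′} h in ∩⁺ (∊-respʳ (≅-sym p) a) b)

⋃⁺ : ∀ {x y z} → z ∊ y → y ∊ x → z ∊ ⋃ x
⋃⁺ z∊y y∊x = let h = ∊-respʳ (≅-index y∊x) z∊y in ∊-intro (index y∊x , index h) (≅-index h)

⋃⁻ : ∀ {x z} → z ∊ ⋃ x → ∃[ i ] z ∊ element x i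
⋃⁻ (∈⇒∊ ((i , j) , p)) = i , ∈⇒∊ (j , p)

-- Ordinals

IsTransitive : V → Set₁
IsTransitive x = ∀ {y z} → z ∊ y → y ∊ x → z ∊ x

record IsOrdinal (x : V) : Set₁ where
  constructor ordinal
  field
    transitive         : IsTransitive x
    elementsTransitive : ∀ {y} → y ∊ x → IsTransitive y
open IsOrdinal

IsTransitive-resp : ∀ {x y} → x ≅ y → IsTransitive x → IsTransitive y
IsTransitive-resp p t a b = ∊-respʳ p (t a (∊-respʳ (≅-sym p) b))

IsOrdinal-resp : ∀ {x y} → x ≅ y → IsOrdinal x → IsOrdinal y
IsOrdinal-resp p (ordinal t e) = ordinal (IsTransitive-resp p t) (e ∘ ∊-respʳ (≅-sym p))

IsOrdinal-∊ : ∀ {x y} → IsOrdinal x → y ∊ x → IsOrdinal y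
IsOrdinal-∊ (ordinal t e) y∊x = ordinal (e y∊x) (λ z∊y → e (t z∊y y∊x))

IsTransitive-insert : ∀ {x y} → IsTransitive x → (∀ {z} → z ∊ y → z ∊ x) →
                      IsTransitive (insert y x)
IsTransitive-insert t s z∊w w∊ =
  insert⁺ ([ (λ w∊x → t z∊w w∊x) , (λ p → s (∊-respʳ p z∊w)) ]′ (insert⁻ w∊))

IsOrdinal-succ : ∀ {x} → IsOrdinal x → IsOrdinal (succ x)
IsOrdinal-succ {x} (ordinal t e) = ordinal
  (IsTransitive-insert t id)
  (λ y∊s → [ e , (λ p → IsTransitive-resp (≅-sym p) t) ]′ (succ⁻ y∊s))

IsTransitive-⋃ : ∀ {x} → (∀ i → IsTransitive (element x i)) → IsTransitive (⋃ x)
IsTransitive-⋃ {x} t z∊y y∊⋃ = let i , h = ⋃⁻ {x} y∊⋃ in ⋃⁺ (t i z∊y h) (∊-element x i)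

IsOrdinal-⋃ : ∀ {x} → (∀ i → IsOrdinal (element x i)) → IsOrdinal (⋃ x)
IsOrdinal-⋃ {x} o = ordinal
  (IsTransitive-⋃ {x} (λ i → transitive (o i)))
  (λ y∊⋃ → let i , h = ⋃⁻ {x} y∊⋃ in elementsTransitive (o i) h)

nat : ℕ → V
nat zero    = ∅
nat (suc n) = succ (nat n)

ω : V
ω = sup ℕ nat

nat-∊⁺ : ∀ {m n} → m ℕ.< n → nat m ∊ nat n
nat-∊⁺ {m} {suc n} (ℕ.s≤s m≤n) with ℕₚ.m≤n⇒m<n∨m≡n m≤n
... | inj₁ m<n  = succ⁺ (nat-∊⁺ m<n)
... | inj₂ refl = ∊-succ (nat m)

nat-∊⁻ : ∀ n {z} → z ∊ nat n → ∃[ m ] m ℕ.< n × z ≅ nat m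
nat-∊⁻ zero (∈⇒∊ (() , _))
nat-∊⁻ (suc n) z∊ with succ⁻ z∊
... | inj₁ h = let m , m<n , p = nat-∊⁻ n h in m , ℕₚ.m<n⇒m<1+n m<n , p
... | inj₂ p = n , ℕₚ.n<1+n n , p

nat-injective : ∀ {m n} → nat m ≅ nat n → m ≡ n
nat-injective {m} {n} p with ℕₚ.<-cmp m n
... | tri< m<n _ _ = ⊥-elim (∊-irrefl p (nat-∊⁺ m<n))
... | tri≈ _ m≡n _ = m≡n
... | tri> _ _ n<m = ⊥-elim (∊-irrefl (≅-sym p) (nat-∊⁺ n<m))

nat-ordinal : ∀ n → IsOrdinal (nat n)
nat-ordinal zero    = ordinal (λ { _ (∈⇒∊ (() , _)) }) (λ { (∈⇒∊ (() , _)) })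
nat-ordinal (suc n) = IsOrdinal-succ (nat-ordinal n)

ω-ordinal : IsOrdinal ω
ω-ordinal = ordinal
  (λ z∊y y∊ω → let m , _ , p = nat-∊⁻ (index y∊ω) (∊-respʳ (≅-index y∊ω) z∊y) in ∊-intro m p)
  (λ y∊ω → IsTransitive-resp (≅-sym (≅-index y∊ω)) (transitive (nat-ordinal (index y∊ω))))

module _ {A : Set} {_<_ : Rel A 0ℓ} where

  collapse-irrelevant : ∀ {a} (p q : Acc _<_ a) → collapse a p ≅ collapse a q
  collapse-irrelevant (acc p) (acc q) = ≈⇒≅
    ( (λ (b , b<a) → (b , b<a) , ≅⇒≈ (collapse-irrelevant (p b<a) (q b<a)))
    , (λ (b , b<a) → (b , b<a) , ≅⇒≈ (collapse-irrelevant (p b<a) (q b<a))) )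

  collapse-∊⁺ : ∀ {a b} (p : Acc _<_ a) (q : Acc _<_ b) → b < a → collapse b q ∊ collapse a p
  collapse-∊⁺ (acc p) q b<a = ∊-intro (_ , b<a) (collapse-irrelevant q (p b<a))

  collapse-∊⁻ : ∀ {a z} (p : Acc _<_ a) → z ∊ collapse a p →
                ∃[ b ] b < a × Σ[ q ∈ Acc _<_ b ] z ≅ collapse b q
  collapse-∊⁻ (acc p) (∈⇒∊ ((b , b<a) , h)) = b , b<a , p b<a , ≈⇒≅ h

  collapse-transitive : Transitive _<_ → ∀ {a} (p : Acc _<_ a) → IsTransitive (collapse a p)
  collapse-transitive tr p z∊y y∊ =
    let b , b<a , q , y≅ = collapse-∊⁻ p y∊
        c , c<b , r , z≅ = collapse-∊⁻ q (∊-respʳ y≅ z∊y)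
    in ∊-respˡ (≅-sym z≅) (collapse-∊⁺ p r (tr c<b b<a))

  collapse-ordinal : Transitive _<_ → ∀ {a} (p : Acc _<_ a) → IsOrdinal (collapse a p)
  collapse-ordinal tr p = ordinal (collapse-transitive tr p) λ y∊ →
    let b , _ , q , y≅ = collapse-∊⁻ p y∊
    in IsTransitive-resp (≅-sym y≅) (collapse-transitive tr q)

-- Transitive closure

trcl⁺ : ∀ x {z} → z ∊ x → z ∊ trcl x
trcl⁺ (sup A f) (∈⇒∊ (i , p)) = ∈⇒∊ (inj₁ i , p)

trcl-transitive : ∀ x → IsTransitive (trcl x)
trcl-transitive (sup A f) z∊y (∈⇒∊ (inj₁ i , p)) =
  let h = trcl⁺ (f i) (∊-respʳ (≈⇒≅ p) z∊y) in ∊-intro (inj₂ (i , index h)) (≅-index h)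
trcl-transitive (sup A f) z∊y (∈⇒∊ (inj₂ (i , j) , p)) =
  let h = trcl-transitive (f i) z∊y (∈⇒∊ (j , p)) in ∊-intro (inj₂ (i , index h)) (≅-index h)

trcl-⊆ : ∀ {x} → IsTransitive x → ∀ y → (∀ {z} → z ∊ y → z ∊ x) → ∀ {z} → z ∊ trcl y → z ∊ x
trcl-⊆ t (sup A f) s (∈⇒∊ (inj₁ i , p))       = s (∈⇒∊ (i , p))
trcl-⊆ t (sup A f) s (∈⇒∊ (inj₂ (i , j) , p)) =
  trcl-⊆ t (f i) (λ z∊ → t z∊ (s (∊-element (sup A f) i))) (∈⇒∊ (j , p))

-- Countability and choice

double : ℕ → ℕ
double zero    = zero
double (suc n) = suc (suc (double n))

double-injective : ∀ {m n} → double m ≡ double n → m ≡ n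
double-injective {zero}  {zero}  _ = refl
double-injective {suc m} {suc n} p =
  cong suc (double-injective (ℕₚ.suc-injective (ℕₚ.suc-injective p)))

double≢1+double : ∀ m n → double m ≢ suc (double n)
double≢1+double (suc m) (suc n) p =
  double≢1+double m n (ℕₚ.suc-injective (ℕₚ.suc-injective p))

-- pair m n = 2^m (2n + 1)
pair : ℕ → ℕ → ℕ
pair zero    n = suc (double n)
pair (suc m) n = double (pair m n)

pair-injective : ∀ m m′ {n n′} → pair m n ≡ pair m′ n′ → m ≡ m′ × n ≡ n′
pair-injective zero    zero     p = refl , double-injective (ℕₚ.suc-injective p)
pair-injective zero    (suc m′) p = ⊥-elim (double≢1+double _ _ (sym p))
pair-injective (suc m) zero     p = ⊥-elim (double≢1+double _ _ p)
pair-injective (suc m) (suc m′) p =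
  let q , r = pair-injective m m′ (double-injective p) in cong suc q , r

-- The code may depend on the proof of `P x` and need not respect `_~_`. Asking only for injectivity
-- makes subsets, preimages and unions of given codings immediate; `countable⁺` recovers an
-- injection of setoids through representatives.
record CountablyMany {A : Set a} (_~_ : A → A → Set) (P : A → Set ℓ) : Set (a ⊔ ℓ) where
  field
    code           : ∀ x → P x → ℕ
    code-injective : ∀ {x y} (p : P x) (q : P y) → code x p ≡ code y q → x ~ y
open CountablyMany

module _ {A : Set a} {_~_ : A → A → Set} where

  countablyMany-⊆ : {P : A → Set ℓ} {Q : A → Set ℓ′} → (∀ {x} → P x → Q x) →
                    CountablyMany _~_ Q → CountablyMany _~_ P
  countablyMany-⊆ s c = record
    { code           = λ x p → code c x (s p)
    ; code-injective = λ p q → code-injective c (s p) (s q)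
    }

  countablyMany-preimage : {B : Set b} {_≋_ : B → B → Set} {P : A → Set ℓ} {Q : B → Set ℓ′}
    (f : A → B) → (∀ {x} → P x → Q (f x)) →
    (∀ {x y} → P x → P y → f x ≋ f y → x ~ y) →
    CountablyMany _≋_ Q → CountablyMany _~_ P
  countablyMany-preimage f s inj c = record
    { code           = λ x p → code c (f x) (s p)
    ; code-injective = λ p q e → inj p q (code-injective c (s p) (s q) e)
    }

  countablyMany-∪ : {P : A → Set ℓ} {Q : ℕ → A → Set ℓ′} →
    (∀ {x} → P x → ∃[ n ] Q n x) → (∀ n → CountablyMany _~_ (Q n)) → CountablyMany _~_ P
  countablyMany-∪ {P = P} {Q} s c = record { code = f ; code-injective = inj }
    where
    f : ∀ x → P x → ℕ
    f x p = let n , q = s p in pair n (code (c n) x q)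
    inj : ∀ {x y} (p : P x) (q : P y) → f x p ≡ f y q → x ~ y
    inj p q e = aux (s p) (s q) (pair-injective _ _ e)
      where
      aux : ∀ {x y} (u : ∃[ n ] Q n x) (v : ∃[ n ] Q n y) →
            proj₁ u ≡ proj₁ v × code (c (proj₁ u)) x (proj₂ u) ≡ code (c (proj₁ v)) y (proj₂ v) →
            x ~ y
      aux (n , u) (.n , v) (refl , e) = code-injective (c n) u v e

module Choice (em : ∀ {ℓ} → ExcludedMiddle ℓ) (ext : ∀ {a b} → Extensionality a b) where

  dne : {A : Set ℓ} → ¬ ¬ A → A
  dne {A = A} h with em {P = A}
  ... | yes x = x
  ... | no ¬x = ⊥-elim (h ¬x)

  ⌊_⌋ : Set ℓ → Bool
  ⌊ A ⌋ = does (em {P = A})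

  ⌊⌋⁺ : {A : Set ℓ} → A → T ⌊ A ⌋
  ⌊⌋⁺ {A = A} x with em {P = A}
  ... | yes _ = tt
  ... | no ¬x = ¬x x

  ⌊⌋⁻ : {A : Set ℓ} → T ⌊ A ⌋ → A
  ⌊⌋⁻ {A = A} t with em {P = A}
  ... | yes x = x

  ⌊⌋-cong : {A B : Set ℓ} → (A → B) → (B → A) → ⌊ A ⌋ ≡ ⌊ B ⌋
  ⌊⌋-cong {A = A} {B} f g with em {P = A} | em {P = B}
  ... | yes _ | yes _ = refl
  ... | yes x | no ¬y = ⊥-elim (¬y (f x))
  ... | no ¬x | yes y = ⊥-elim (¬x (g y))
  ... | no _  | no _  = refl

  -- Choice from excluded middle: `em` at the type of points satisfying a Boolean predicate returns
  -- an actual point. Equivalent points have the same class as a predicate, by function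
  -- extensionality, and so receive the same representative.
  module Representatives (S : Setoid 0ℓ 0ℓ) where
    open Setoid S renaming (refl to ≈ₛ-refl; sym to ≈ₛ-sym; trans to ≈ₛ-trans; _≈_ to _≈ₛ_)

    private
      pick : (Carrier → Bool) → Maybe Carrier
      pick χ with em {P = Σ[ y ∈ Carrier ] T (χ y)}
      ... | yes (y , _) = just y
      ... | no _        = nothing

      pick-just : ∀ χ {x} → T (χ x) → ∃[ y ] pick χ ≡ just y × T (χ y)
      pick-just χ {x} t with em {P = Σ[ y ∈ Carrier ] T (χ y)}
      ... | yes (y , t′) = y , refl , t′
      ... | no ¬∃        = ⊥-elim (¬∃ (x , t))

      class : Carrier → Carrier → Bool
      class x y = ⌊ x ≈ₛ y ⌋

      chosen : ∀ x → ∃[ y ] pick (class x) ≡ just y × T (class x y)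
      chosen x = pick-just (class x) (⌊⌋⁺ ≈ₛ-refl)

    rep : Carrier → Carrier
    rep x = proj₁ (chosen x)

    rep-≈ : ∀ x → x ≈ₛ rep x
    rep-≈ x = ⌊⌋⁻ (proj₂ (proj₂ (chosen x)))

    rep-cong : ∀ {x y} → x ≈ₛ y → rep x ≡ rep y
    rep-cong {x} {y} p = just-inj (trans (sym (proj₁ (proj₂ (chosen x))))
        (trans (cong pick (ext λ z → ⌊⌋-cong (≈ₛ-trans (≈ₛ-sym p)) (≈ₛ-trans p)))
               (proj₁ (proj₂ (chosen y)))))
      where
      just-inj : ∀ {u v : Carrier} → just u ≡ just v → u ≡ v
      just-inj refl = refl

    injection : (T : Setoid 0ℓ 0ℓ) (f : Carrier → Setoid.Carrier T) →
                (∀ {x y} → Setoid._≈_ T (f x) (f y) → x ≈ₛ y) → Injection S T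
    injection T f inj = record
      { to        = f ∘ rep
      ; cong      = λ p → Setoid.reflexive T (cong f (rep-cong p))
      ; injective = λ e → ≈ₛ-trans (rep-≈ _) (≈ₛ-trans (inj e) (≈ₛ-sym (rep-≈ _)))
      }

  module _ {S : Setoid 0ℓ 0ℓ} {P : Pred (Setoid.Carrier S) 0ℓ} where

    countable⁺ : CountablyMany (Setoid._≈_ S) P → Countable (Subsetoid S P)
    countable⁺ c = Representatives.injection (Subsetoid S P) (setoid ℕ)
      (λ (x , p) → code c x p) (λ {(x , p)} {(y , q)} → code-injective c p q)

    countable⁻ : Countable (Subsetoid S P) → CountablyMany (Setoid._≈_ S) P
    countable⁻ i = record
      { code           = λ x p → Injection.to i (x , p)
      ; code-injective = λ p q e → Injection.injective i e
      }

  module _ {A : Set a} {_~_ : A → A → Set} {B : Set b} {_≋_ : B → B → Set} where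

    -- Members with the same code are equivalent, but their codings in `cR` need not agree. For each
    -- code one member b₀ is fixed by excluded middle, and `resp` moves the whole fibre into the set
    -- attached to b₀.
    countablyMany-⋃ : {P : A → Set ℓ} {M : B → Set ℓ′} {R : B → A → Set} →
      CountablyMany _≋_ M → (∀ {b b′ x} → b ≋ b′ → R b x → R b′ x) →
      (∀ {b} → M b → CountablyMany _~_ (R b)) →
      (∀ {x} → P x → ∃[ b ] M b × R b x) → CountablyMany _~_ P
    countablyMany-⋃ {M = M} {R} cM resp cR s = countablyMany-∪
      {Q = λ n x → Σ[ b ∈ B ] Σ[ m ∈ M b ] (code cM b m ≡ n × R b x)}
      (λ p → let b , m , r = s p in _ , b , m , refl , r)
      fibre
      where
      fibre : ∀ n → CountablyMany _~_ (λ x → Σ[ b ∈ B ] Σ[ m ∈ M b ] (code cM b m ≡ n × R b x))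
      fibre n with em {P = Σ[ b ∈ B ] Σ[ m ∈ M b ] code cM b m ≡ n}
      ... | yes (b₀ , m₀ , e₀) = countablyMany-⊆
              (λ (b , m , e , r) → resp (code-injective cM m m₀ (trans e (sym e₀))) r) (cR m₀)
      ... | no ¬∃ = record
              { code           = λ _ _ → 0
              ; code-injective = λ (b , m , e , _) → ⊥-elim (¬∃ (b , m , e))
              }

-- The ordinal ω₁

CountableSet : V → Set₁
CountableSet x = CountablyMany _≅_ (_∊ x)

module _ {A : Set} {_<_ : Rel A 0ℓ} where

  collapse-countable : ∀ {a} (p : Acc _<_ a) → CountablyMany _≡_ (_< a) → CountableSet (collapse a p)
  collapse-countable {a} p c = record
    { code           = λ z z∊ → let b , b<a , _ = collapse-∊⁻ p z∊ in code c b b<a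
    ; code-injective = λ y∊ z∊ e →
        let _ , b<a , q , y≅ = collapse-∊⁻ p y∊
            _ , c<a , r , z≅ = collapse-∊⁻ p z∊
        in same q r (code-injective c b<a c<a e) y≅ z≅
    }
    where
    same : ∀ {b b′ y z} (q : Acc _<_ b) (r : Acc _<_ b′) → b ≡ b′ →
           y ≅ collapse b q → z ≅ collapse b′ r → y ≅ z
    same q r refl y≅ z≅ = ≅-trans y≅ (≅-trans (collapse-irrelevant q r) (≅-sym z≅))

succ-countable : ∀ {x} → CountableSet x → CountableSet (succ x)
succ-countable {x} c = record
  { code           = λ z h → f z (succ⁻ h)
  ; code-injective = λ p q → inj (succ⁻ p) (succ⁻ q)
  }
  where
  f : ∀ z → z ∊ x ⊎ z ≅ x → ℕ
  f z (inj₁ h) = suc (code c z h)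
  f z (inj₂ _) = 0
  inj : ∀ {y z} (p : y ∊ x ⊎ y ≅ x) (q : z ∊ x ⊎ z ≅ x) → f y p ≡ f z q → y ≅ z
  inj (inj₁ p) (inj₁ q) e = code-injective c p q (ℕₚ.suc-injective e)
  inj (inj₂ p) (inj₂ q) _ = ≅-trans p (≅-sym q)

ω-countable : CountableSet ω
ω-countable = record
  { code           = λ _ → index
  ; code-injective = λ p q e →
      ≅-trans (≅-index p) (subst (λ n → nat n ≅ _) (sym e) (≅-sym (≅-index q)))
  }

module Uncountable (em : ∀ {ℓ} → ExcludedMiddle ℓ) (ext : ∀ {a b} → Extensionality a b) where
  open Choice em ext

  compare : ∀ {x y} → IsOrdinal x → IsOrdinal y → x ∊ y ⊎ x ≅ y ⊎ y ∊ x
  compare = go (∊-wellFounded _) (∊-wellFounded _)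
    where
    go : ∀ {x y} → Acc _∊_ x → Acc _∊_ y → IsOrdinal x → IsOrdinal y → x ∊ y ⊎ x ≅ y ⊎ y ∊ x
    go {x} {y} ax@(acc rx) ay@(acc ry) ox oy
      with em {P = y ∊ x} | em {P = x ∊ y}
    ... | yes y∊x | _       = inj₂ (inj₂ y∊x)
    ... | no _    | yes x∊y = inj₁ x∊y
    ... | no y∉x  | no x∉y  = inj₂ (inj₁ (≅-ext
      (λ z∊x → [ id , [ (λ p → ⊥-elim (y∉x (∊-respˡ p z∊x)))
                      , (λ y∊z → ⊥-elim (y∉x (transitive ox y∊z z∊x))) ]′ ]′
               (go (rx z∊x) ay (IsOrdinal-∊ ox z∊x) oy))
      (λ z∊y → [ (λ x∊z → ⊥-elim (x∉y (transitive oy x∊z z∊y)))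
               , [ (λ p → ⊥-elim (x∉y (∊-respˡ (≅-sym p) z∊y))) , id ]′ ]′
               (go ax (ry z∊y) ox (IsOrdinal-∊ oy z∊y)))))

  ∊ω₁⁻ : ∀ {z} → z ∊ ω₁ → IsOrdinal z × CountableSet z
  ∊ω₁⁻ z∊ω₁ = let R , tr , wf = index z∊ω₁ ; z≅ = ≅-index z∊ω₁ in
    IsOrdinal-resp (≅-sym z≅) (collapse-ordinal (λ {i} {j} {k} → tr {i} {j} {k}) (wf 0)) ,
    countablyMany-⊆ (∊-respʳ z≅) (collapse-countable (wf 0) (record
      { code = λ n _ → n ; code-injective = λ _ _ e → e }))

  ∊ω₁⁺ : ∀ {x} → IsOrdinal x → CountableSet x → x ∊ ω₁
  ∊ω₁⁺ {x} ox c =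
    ∊-intro (R , (λ {i} {j} {k} → R-transitive {i} {j} {k}) , R-wf) (≅-sym (collapse-dec 0 (R-wf 0) id))
    where
    preimage : ℕ → Set₁
    preimage n = Σ[ z ∈ V ] Σ[ h ∈ z ∊ x ] code c z h ≡ n

    decode : ∀ {n} → Dec (preimage n) → V
    decode (yes (z , _)) = z
    decode (no _)        = x

    dec : ℕ → V
    dec zero    = x
    dec (suc n) = decode (em {P = preimage n})

    decode-ordinal : ∀ {n} (d : Dec (preimage n)) → IsOrdinal (decode d)
    decode-ordinal (yes (_ , h , _)) = IsOrdinal-∊ ox h
    decode-ordinal (no _)            = ox

    dec-ordinal : ∀ n → IsOrdinal (dec n)
    dec-ordinal zero    = ox
    dec-ordinal (suc n) = decode-ordinal em

    decode-onto : ∀ {z} (h : z ∊ x) (d : Dec (preimage (code c z h))) → z ≅ decode d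
    decode-onto h (yes (_ , h′ , e)) = code-injective c h h′ (sym e)
    decode-onto h (no ¬∃)            = ⊥-elim (¬∃ (_ , h , refl))

    R : ℕ → ℕ → Bool
    R m n = ⌊ dec m ∊ dec n ⌋

    R-transitive : Transitive (λ m n → T (R m n))
    R-transitive {l} {m} {n} p q =
      ⌊⌋⁺ {A = dec l ∊ dec n} (transitive (dec-ordinal n)
        (⌊⌋⁻ {A = dec l ∊ dec m} p) (⌊⌋⁻ {A = dec m ∊ dec n} q))

    R-wf : WellFounded (λ m n → T (R m n))
    R-wf = WF.Subrelation.wellFounded ⌊⌋⁻ (On.wellFounded dec ∊-wellFounded)

    collapse-dec : ∀ n (p : Acc (λ m n → T (R m n)) n) → (∀ {z} → z ∊ dec n → z ∊ x) →
                   collapse n p ≅ dec n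
    collapse-dec n (acc p) s = ≅-ext
      (λ { (∈⇒∊ ((m , Rmn) , z≈)) → let m∊n = ⌊⌋⁻ Rmn in
           ∊-respˡ (≅-sym (≅-trans (≈⇒≅ z≈) (below m Rmn))) m∊n })
      (λ z∊n → let m = suc (code c _ (s z∊n))
                   z≅ = decode-onto (s z∊n) em
                   Rmn = ⌊⌋⁺ (∊-respˡ z≅ z∊n)
               in ∊-intro (m , Rmn) (≅-trans z≅ (≅-sym (below m Rmn))))
      where
      below : ∀ m (Rmn : T (R m n)) → collapse m (p Rmn) ≅ dec m
      below m Rmn = collapse-dec m (p Rmn) (λ z∊m → s (transitive (dec-ordinal n) z∊m (⌊⌋⁻ Rmn)))

  ω₁-ordinal : IsOrdinal ω₁
  ω₁-ordinal = ordinal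
    (λ z∊y y∊ω₁ → let oy , cy = ∊ω₁⁻ y∊ω₁ in
      ∊ω₁⁺ (IsOrdinal-∊ oy z∊y) (countablyMany-⊆ (λ w∊z → transitive oy w∊z z∊y) cy))
    (λ y∊ω₁ → transitive (proj₁ (∊ω₁⁻ y∊ω₁)))

  -- Burali-Forti: were it countable, ω₁ would be one of its own elements.
  ω₁-uncountable : ¬ CountableSet ω₁
  ω₁-uncountable c = ∊-irrefl ≅-refl (∊ω₁⁺ ω₁-ordinal c)

  -- One index of ω₁ for each countable ordinal, so that _≡_ is equality of ordinals.

  private module Rep = Representatives (Elements ω₁)

  abstract
    K : Set
    K = Σ[ i ∈ Index ω₁ ] i ≡ Rep.rep i

    ⌜_⌝ : K → V
    ⌜ i , _ ⌝ = element ω₁ i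

    ⌜⌝∊ω₁ : ∀ k → ⌜ k ⌝ ∊ ω₁
    ⌜⌝∊ω₁ (i , _) = ∊-element ω₁ i

    ⌜⌝-injective : ∀ {k l} → ⌜ k ⌝ ≅ ⌜ l ⌝ → k ≡ l
    ⌜⌝-injective {i , p} {j , q} (≈⇒≅ e) = aux (trans p (trans (Rep.rep-cong e) (sym q))) p q
      where
      aux : ∀ {i j} → i ≡ j → (p : i ≡ Rep.rep i) (q : j ≡ Rep.rep j) →
            _≡_ {A = Σ[ i ∈ Index ω₁ ] i ≡ Rep.rep i} (i , p) (j , q)
      aux refl p q = cong (_ ,_) (uip p q)

    point : ∀ {z} → z ∊ ω₁ → K
    point h = Rep.rep (index h) , Rep.rep-cong (Rep.rep-≈ (index h))

    ≅-point : ∀ {z} (h : z ∊ ω₁) → z ≅ ⌜ point h ⌝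
    ≅-point h = ≅-trans (≅-index h) (≈⇒≅ (Rep.rep-≈ (index h)))

  ⌜⌝-ordinal : ∀ k → IsOrdinal ⌜ k ⌝
  ⌜⌝-ordinal k = proj₁ (∊ω₁⁻ (⌜⌝∊ω₁ k))

  K-uncountable : ¬ CountablyMany {A = K} _≡_ (λ _ → ⊤)
  K-uncountable c = ω₁-uncountable record
    { code           = λ _ h → code c (point h) tt
    ; code-injective = λ p q e → ≅-trans (≅-point p)
        (subst (λ k → ⌜ k ⌝ ≅ _) (sym (code-injective c tt tt e)) (≅-sym (≅-point q)))
    }

  infix 4 _<ₖ_ _≤ₖ_

  _<ₖ_ _≤ₖ_ : K → K → Set
  k <ₖ l = ⌜ k ⌝ ∊ ⌜ l ⌝
  k ≤ₖ l = ⌜ k ⌝ ∊ succ ⌜ l ⌝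

  <ₖ-wellFounded : WellFounded _<ₖ_
  <ₖ-wellFounded = On.wellFounded ⌜_⌝ ∊-wellFounded

  <ₖ-trans : Transitive _<ₖ_
  <ₖ-trans {k = m} p q = transitive (⌜⌝-ordinal m) p q

  <ₖ-compare : ∀ k l → k <ₖ l ⊎ k ≡ l ⊎ l <ₖ k
  <ₖ-compare k l with compare (⌜⌝-ordinal k) (⌜⌝-ordinal l)
  ... | inj₁ p        = inj₁ p
  ... | inj₂ (inj₁ p) = inj₂ (inj₁ (⌜⌝-injective p))
  ... | inj₂ (inj₂ p) = inj₂ (inj₂ p)

  ≤ₖ-countable : ∀ k → CountablyMany _≡_ (_≤ₖ k)
  ≤ₖ-countable k = countablyMany-preimage ⌜_⌝ id (λ _ _ → ⌜⌝-injective)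
    (succ-countable (proj₂ (∊ω₁⁻ (⌜⌝∊ω₁ k))))

  -- The order type of the predecessors of (k , n) is ω · k + n.
  private
    _≺_ : Rel (K × ℕ) 0ℓ
    _≺_ = Lex.×-Lex _≡_ _<ₖ_ ℕ._<_

    ≺-wf : WellFounded _≺_
    ≺-wf = Lex.×-wellFounded <ₖ-wellFounded <-wellFounded

    ≺-trans : Transitive _≺_
    ≺-trans (inj₁ p)          (inj₁ q)          = inj₁ (<ₖ-trans p q)
    ≺-trans (inj₁ p)          (inj₂ (refl , _)) = inj₁ p
    ≺-trans (inj₂ (refl , _)) (inj₁ q)          = inj₁ q
    ≺-trans (inj₂ (refl , p)) (inj₂ (refl , q)) = inj₂ (refl , ℕₚ.<-trans p q)

    ≺-countable : ∀ s → CountablyMany _≡_ (_≺ s)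
    ≺-countable (k , n) = record
      { code           = λ (l , m) p → pair (code (≤ₖ-countable k) l (weaken p)) m
      ; code-injective = λ p q e → let e₁ , e₂ = pair-injective _ _ e in
          cong₂ _,_ (code-injective (≤ₖ-countable k) (weaken p) (weaken q) e₁) e₂
      }
      where
      weaken : ∀ {l m} → (l , m) ≺ (k , n) → l ≤ₖ k
      weaken (inj₁ p)          = succ⁺ p
      weaken (inj₂ (refl , _)) = ∊-succ ⌜ k ⌝

    place∊ω₁ : ∀ s → collapse s (≺-wf s) ∊ ω₁
    place∊ω₁ s = ∊ω₁⁺ (collapse-ordinal (λ {i} → ≺-trans {i}) (≺-wf s))
                      (collapse-countable (≺-wf s) (≺-countable s))

    place-≺ : ∀ {s t} → s ≺ t → ¬ collapse s (≺-wf s) ≅ collapse t (≺-wf t)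
    place-≺ {s} {t} s≺t p = ∊-irrefl p (collapse-∊⁺ (≺-wf t) (≺-wf s) s≺t)

    place-injective : ∀ {s t} → collapse s (≺-wf s) ≅ collapse t (≺-wf t) → s ≡ t
    place-injective {k , m} {l , n} p with <ₖ-compare k l
    ... | inj₁ k<l        = ⊥-elim (place-≺ (inj₁ k<l) p)
    ... | inj₂ (inj₂ l<k) = ⊥-elim (place-≺ (inj₁ l<k) (≅-sym p))
    ... | inj₂ (inj₁ refl) with ℕₚ.<-cmp m n
    ...   | tri< m<n _ _ = ⊥-elim (place-≺ (inj₂ (refl , m<n)) p)
    ...   | tri≈ _ m≡n _ = cong (k ,_) m≡n
    ...   | tri> _ _ n<m = ⊥-elim (place-≺ (inj₂ (refl , n<m)) (≅-sym p))

  abstract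
    number : K × ℕ → K
    number s = point (place∊ω₁ s)

    number-injective : ∀ {s t} → number s ≡ number t → s ≡ t
    number-injective {s} {t} e = place-injective (≅-trans (≅-point (place∊ω₁ s))
      (subst (λ k → ⌜ k ⌝ ≅ _) (sym e) (≅-sym (≅-point (place∊ω₁ t)))))

  module _ {A : Set} {_~_ : A → A → Set} (f : A → K)
           (fibre : ∀ k → CountablyMany _~_ (λ x → f x ≡ k)) where

    abstract
      -- This is ω₁ · ω = ω₁: a point is recorded by its image together with its code in the
      -- countable fibre. It serves for pairing on `K`, where the map is the maximum, and for coding
      -- the nodes of a Suslin tree, where it is the level.
      embed : A → K
      embed x = number (f x , code (fibre (f x)) x refl)

      embed-injective : ∀ {x y} → embed x ≡ embed y → x ~ y
      embed-injective {x} {y} e = aux refl refl (cong proj₁ e′) (cong proj₂ e′)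
        where
        e′ : (f x , code (fibre (f x)) x refl) ≡ (f y , code (fibre (f y)) y refl)
        e′ = number-injective e
        aux : ∀ {k l} (p : f x ≡ k) (q : f y ≡ l) → k ≡ l →
              code (fibre k) x p ≡ code (fibre l) y q → x ~ y
        aux p q refl e = code-injective (fibre _) p q e

  private
    max : K × K → K
    max (k , l) with em {P = k ≤ₖ l}
    ... | yes _ = l
    ... | no _  = k

    max-upper : ∀ k l → k ≤ₖ max (k , l) × l ≤ₖ max (k , l)
    max-upper k l with em {P = k ≤ₖ l}
    ... | yes k≤l = k≤l , ∊-succ ⌜ l ⌝
    ... | no k≰l with <ₖ-compare k l
    ...   | inj₁ k<l         = ⊥-elim (k≰l (succ⁺ k<l))
    ...   | inj₂ (inj₁ refl) = ⊥-elim (k≰l (∊-succ ⌜ k ⌝))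
    ...   | inj₂ (inj₂ l<k)  = ∊-succ ⌜ k ⌝ , succ⁺ l<k

    max-fibre : ∀ m → CountablyMany _≡_ (λ s → max s ≡ m)
    max-fibre m = record
      { code           = λ s e → let p , q = below e in pair (code (≤ₖ-countable m) (proj₁ s) p)
                                                             (code (≤ₖ-countable m) (proj₂ s) q)
      ; code-injective = λ e e′ h →
          let p , q = below e ; p′ , q′ = below e′ ; h₁ , h₂ = pair-injective _ _ h in
          cong₂ _,_ (code-injective (≤ₖ-countable m) p p′ h₁)
                    (code-injective (≤ₖ-countable m) q q′ h₂)
      }
      where
      below : ∀ {s} → max s ≡ m → proj₁ s ≤ₖ m × proj₂ s ≤ₖ m
      below refl = max-upper _ _

  pairₖ : K × K → K
  pairₖ = embed max max-fibre

  pairₖ-injective : ∀ {s t} → pairₖ s ≡ pairₖ t → s ≡ t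
  pairₖ-injective = embed-injective max max-fibre

  0ₖ : K
  0ₖ = point (∊ω₁⁺ (nat-ordinal 0)
    (record { code = λ { _ (∈⇒∊ (() , _)) } ; code-injective = λ { (∈⇒∊ (() , _)) } }))

  -- Lists index the finite iterations of the maps sending x to `x ∩ E k` when a model is closed
  -- under them. The tags 0 and 1 keep the empty list apart from the others.
  listₖ : List K → K
  listₖ []       = number (0ₖ , 0)
  listₖ (k ∷ ks) = number (pairₖ (k , listₖ ks) , 1)

  listₖ-injective : ∀ ks ls → listₖ ks ≡ listₖ ls → ks ≡ ls
  listₖ-injective []       []       _ = refl
  listₖ-injective []       (l ∷ ls) e with () ← cong proj₂ (number-injective e)
  listₖ-injective (k ∷ ks) []       e with () ← cong proj₂ (number-injective e)
  listₖ-injective (k ∷ ks) (l ∷ ls) e =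
    let e′ = pairₖ-injective (cong proj₁ (number-injective e)) in
    cong₂ _∷_ (cong proj₁ e′) (listₖ-injective ks ls (cong proj₂ e′))

  -- Size at most ω₁, stated by an enumeration along `K` of some superset of x. Values outside x are
  -- allowed, so the empty set and subsets are no special case.
  record Covered (x : V) : Set₁ where
    constructor covered
    field
      cover   : K → V
      covers  : ∀ {z} → z ∊ x → ∃[ k ] z ≅ cover k
  open Covered public

  coveredBy : ∀ {x} {I : Set} (e : I → K) → (∀ {i j} → e i ≡ e j → i ≡ j) →
              (f : I → V) → (∀ {z} → z ∊ x → ∃[ i ] z ≅ f i) → Covered x
  coveredBy {I = I} e inj f c = covered (λ k → value k em)
    (λ z∊x → let i , p = c z∊x in e i , ≅-trans p (value-≅ i em))
    where
    value : ∀ k → Dec (Σ[ i ∈ I ] e i ≡ k) → V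
    value _ (yes (i , _)) = f i
    value _ (no _)        = ∅
    value-≅ : ∀ i (d : Dec (Σ[ j ∈ I ] e j ≡ e i)) → f i ≅ value (e i) d
    value-≅ i (yes (j , q)) = subst (λ j → f i ≅ f j) (sym (inj q)) ≅-refl
    value-≅ i (no ¬∃)       = ⊥-elim (¬∃ (i , refl))

  covered⇒<ω₂ : ∀ {x} → Covered x → ∣ x ∣<ω₂
  covered⇒<ω₂ {x} c = Representatives.injection (Elements x) (Elements ω₁)
    (λ i → index (⌜⌝∊ω₁ (at i))) λ {i} {j} e →
      ≅⇒≈ (≅-trans (≅at i) (subst (λ k → cover c k ≅ _)
        (sym (⌜⌝-injective (≅-trans (≅-index (⌜⌝∊ω₁ (at i)))
          (≅-trans (≈⇒≅ e) (≅-sym (≅-index (⌜⌝∊ω₁ (at j))))))))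
        (≅-sym (≅at j))))
    where
    at : Index x → K
    at i = proj₁ (covers c (∊-element x i))
    ≅at : ∀ i → element x i ≅ cover c (at i)
    ≅at i = proj₂ (covers c (∊-element x i))

  <ω₂⇒covered : ∀ {x} → ∣ x ∣<ω₂ → Covered x
  <ω₂⇒covered {x} ι = covered (λ k → value k em) onto
    where
    open Injection ι using (to; injective)
    preimage : K → Set
    preimage k = Σ[ j ∈ Index x ] element ω₁ (to j) ≅ ⌜ k ⌝
    value : ∀ k → Dec (preimage k) → V
    value _ (yes (j , _)) = element x j
    value _ (no _)        = ∅
    value-≅ : ∀ {j} k → element ω₁ (to j) ≅ ⌜ k ⌝ → (d : Dec (preimage k)) → element x j ≅ value k d
    value-≅ k p (yes (_ , q)) = ≈⇒≅ (injective (≅⇒≈ (≅-trans p (≅-sym q))))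
    value-≅ k p (no ¬∃)       = ⊥-elim (¬∃ (_ , p))
    onto : ∀ {z} → z ∊ x → ∃[ k ] z ≅ value k em
    onto z∊x = point h , ≅-trans (≅-index z∊x) (value-≅ (point h) (≅-point h) em)
      where h = ∊-element ω₁ (to (index z∊x))

  coveredFamily : ∀ {x} {I : Set} (e : I → K) → (∀ {i j} → e i ≡ e j → i ≡ j) →
                  (f : I → V) → (∀ i → Covered (f i)) → (∀ {z} → z ∊ x → ∃[ i ] z ∊ f i) → Covered x
  coveredFamily e inj f c h = coveredBy (λ (i , l) → pairₖ (e i , l))
    (λ q → let q′ = pairₖ-injective q in cong₂ _,_ (inj (cong proj₁ q′)) (cong proj₂ q′))
    (λ (i , l) → cover (c i) l)
    (λ z∊x → let i , z∊fi = h z∊x ; l , p = covers (c i) z∊fi in (i , l) , p)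

  covered-∅ : Covered ∅
  covered-∅ = covered (λ _ → ∅) λ { (∈⇒∊ (() , _)) }

  covered-⊆ : ∀ {x y} → (∀ {z} → z ∊ x → z ∊ y) → Covered y → Covered x
  covered-⊆ s (covered f c) = covered f (c ∘ s)

  covered-insert : ∀ {x y} → Covered x → Covered (insert y x)
  covered-insert {x} {y} c = coveredBy number number-injective f λ z∊ → onto (insert⁻ z∊)
    where
    f : K × ℕ → V
    f (k , zero)  = y
    f (k , suc _) = cover c k
    onto : ∀ {z} → z ∊ x ⊎ z ≅ y → ∃[ i ] z ≅ f i
    onto (inj₁ h) = let k , p = covers c h in (k , 1) , p
    onto (inj₂ p) = (0ₖ , 0) , p

  covered-ω₁ : Covered ω₁
  covered-ω₁ = covered ⌜_⌝ λ z∊ → point z∊ , ≅-point z∊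

  covered-⋃ : ∀ {x} → Covered x → (∀ {y} → y ∊ x → Covered y) → Covered (⋃ x)
  covered-⋃ {x} c cs = coveredFamily id id (λ k → sub k em) (λ k → sub-covered k em)
    λ z∊⋃ → let i , z∊i = ⋃⁻ {x} z∊⋃
                y∊x     = ∊-element x i
                k , p   = covers c y∊x
            in k , sub-∊ k em (∊-respˡ p y∊x) (∊-respʳ p z∊i)
    where
    -- A value of the cover may lie outside x, where `cs` says nothing; it is replaced by the empty
    -- set.
    sub : ∀ k → Dec (cover c k ∊ x) → V
    sub k (yes _) = cover c k
    sub k (no _)  = ∅
    sub-covered : ∀ k d → Covered (sub k d)
    sub-covered k (yes h) = cs h
    sub-covered k (no _)  = covered-∅
    sub-∊ : ∀ k d {z} → cover c k ∊ x → z ∊ cover c k → z ∊ sub k d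
    sub-∊ k (yes _) _ z∊ = z∊
    sub-∊ k (no ¬h) h _  = ⊥-elim (¬h h)

-- A club of models

module Clubs (em : ∀ {ℓ} → ExcludedMiddle ℓ) (ext : ∀ {a b} → Extensionality a b) where
  open Choice em ext
  open Uncountable em ext

  module _ (E : K → V) where

    -- `succ-ω₁∊` makes ω₁ an element of an ordinal of N, hence smaller than the supremum of these
    -- ordinals. Transitivity and the cover together place the elements of N in H(ω₂).
    record Closed (N : V) : Set₁ where
      field
        closed-transitive : IsTransitive N
        isCovered    : Covered N
        succ-ω₁∊     : succ ω₁ ∊ N
        ∩-closed     : ∀ {x} k → x ∊ N → x ∩ E k ∊ N
    open Closed public

    private
      traces : V → List K → V
      traces = foldr (λ k x → x ∩ E k)

      traces-cong : ∀ {x y} ks → x ≅ y → traces x ks ≅ traces y ks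
      traces-cong []       p = p
      traces-cong (k ∷ ks) p = ∩-cong (traces-cong ks p)

      traces-⊆ : ∀ {x z} ks → z ∊ traces x ks → z ∊ x
      traces-⊆ []       h = h
      traces-⊆ {x} (k ∷ ks) h = traces-⊆ ks (proj₁ (∩⁻ {traces x ks} h))

      -- One layer of finite traces over a transitive base suffices: a trace is a subset of an
      -- element of the base, so its elements are back in the base and `N` is transitive. The set
      -- `succ (succ ω₁)` enters the base so that `succ ω₁` is an element of it.
      module Hull (a : V) (cs : ∀ {x} → x ∊ a → Covered (trcl x)) (c : Covered a) where

        D : V
        D = sup (Maybe (Index a))
                (maybe′ (λ i → let y = element a i in insert y (trcl y)) (succ (succ ω₁)))

        base : V
        base = ⋃ D

        base-transitive : IsTransitive base
        base-transitive = IsTransitive-⋃ {D} λ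
          { (just i) → let y = element a i in IsTransitive-insert (trcl-transitive y) (trcl⁺ y)
          ; nothing  → transitive (IsOrdinal-succ (IsOrdinal-succ ω₁-ordinal)) }

        base-covered : Covered base
        base-covered = coveredFamily number number-injective (λ (k , n) → f k n em)
          (λ (k , n) → f-covered k n em) λ z∊ → let d , z∊d = ⋃⁻ {D} z∊ in onto d z∊d
          where
          f : ∀ k → ℕ → Dec (cover c k ∊ a) → V
          f k zero    _       = succ (succ ω₁)
          f k (suc _) (yes _) = insert (cover c k) (trcl (cover c k))
          f k (suc _) (no _)  = ∅
          f-covered : ∀ k n d → Covered (f k n d)
          f-covered k zero    _       = covered-insert (covered-insert covered-ω₁)
          f-covered k (suc _) (yes h) = covered-insert (cs h)
          f-covered k (suc _) (no _)  = covered-∅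
          f-∊ : ∀ k d {y z} → y ∊ a → y ≅ cover c k → z ∊ insert y (trcl y) → z ∊ f k 1 d
          f-∊ k (no ¬h) y∊a p _ = ⊥-elim (¬h (∊-respˡ p y∊a))
          f-∊ k (yes _) {y} y∊a p z∊ with insert⁻ z∊
          ... | inj₂ q = ∊-respˡ (≅-sym (≅-trans q p)) (∊-insert (cover c k) (trcl (cover c k)))
          ... | inj₁ h = insert⁺ (trcl-⊆ (trcl-transitive _) y (λ w∊y → trcl⁺ _ (∊-respʳ p w∊y)) h)
          onto : ∀ {z} d → z ∊ element D d → ∃[ (k , n) ] z ∊ f k n em
          onto nothing  z∊ = (0ₖ , 0) , z∊
          onto (just i) z∊ = let y∊a = ∊-element a i ; k , p = covers c y∊a in
            (k , 1) , f-∊ k em y∊a p z∊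

        N : V
        N = sup (Index base × List K) (λ (i , ks) → traces (element base i) ks)

        base⊆N : ∀ {z} → z ∊ base → z ∊ N
        base⊆N h = ∊-intro (index h , []) (≅-index h)

        N-closed : Closed N
        N-closed = record
          { closed-transitive = λ { z∊y (∈⇒∊ ((i , ks) , p)) → base⊆N (base-transitive
              (traces-⊆ ks (∊-respʳ (≈⇒≅ p) z∊y)) (∊-element base i)) }
          ; isCovered = coveredBy (λ (k , ks) → pairₖ (k , listₖ ks))
              (λ q → let q′ = pairₖ-injective q in
                cong₂ _,_ (cong proj₁ q′) (listₖ-injective _ _ (cong proj₂ q′)))
              (λ (k , ks) → traces (cover base-covered k) ks)
              λ { (∈⇒∊ ((i , ks) , p)) → let k , q = covers base-covered (∊-element base i) in
                  (k , ks) , ≅-trans (≈⇒≅ p) (traces-cong ks q) }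
          ; succ-ω₁∊ = base⊆N (⋃⁺ (∊-succ (succ ω₁)) (∊-element D nothing))
          ; ∩-closed = λ { k (∈⇒∊ ((i , ks) , p)) → ∊-intro (i , k ∷ ks) (∩-cong (≈⇒≅ p)) }
          }

        a⊆N : ∀ {z} → z ∊ a → z ∊ N
        a⊆N h = let y = element a (index h) in
          base⊆N (⋃⁺ (∊-respˡ (≅-sym (≅-index h)) (∊-insert y (trcl y))) (∊-element D (just (index h))))

      closed-resp : ∀ {x y} → x ≅ y → Closed x → Closed y
      closed-resp p c = record
        { closed-transitive = IsTransitive-resp p (closed-transitive c)
        ; isCovered    = covered-⊆ (∊-respʳ (≅-sym p)) (isCovered c)
        ; succ-ω₁∊     = ∊-respʳ p (succ-ω₁∊ c)
        ; ∩-closed     = λ k h → ∊-respʳ p (∩-closed c k (∊-respʳ (≅-sym p) h))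
        }

      closed-⋃ : ∀ {D d} → Covered D → d ∊ D → (∀ {x} → x ∊ D → Closed x) → Closed (⋃ D)
      closed-⋃ {D} cD d∊D cs = record
        { closed-transitive = IsTransitive-⋃ {D} (λ i → closed-transitive (cs (∊-element D i)))
        ; isCovered    = covered-⋃ cD (λ h → isCovered (cs h))
        ; succ-ω₁∊     = ⋃⁺ (succ-ω₁∊ (cs d∊D)) d∊D
        ; ∩-closed     = λ k h → let i , h′ = ⋃⁻ {D} h ; m = ∊-element D i in
                           ⋃⁺ (∩-closed (cs m) k h′) m
        }

    -- `Club` speaks of predicates with values in `Set`, while `Closed` lives one universe higher;
    -- its Boolean truth value brings it down.
    closedSets : V → Set
    closedSets N = T ⌊ Closed N ⌋

    closedSets-club : Club closedSets
    closedSets-club = record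
      { resp      = λ {x} {y} p c → ⌊⌋⁺ {A = Closed y} (closed-resp (≈⇒≅ p) (⌊⌋⁻ {A = Closed x} c))
      ; subset    = λ {a} c′ → let c = ⌊⌋⁻ {A = Closed a} c′ in
          (λ {x} x∈a → covered⇒<ω₂ (covered-⊆
            (trcl-⊆ (closed-transitive c) x (λ z∊x → closed-transitive c z∊x (∈⇒∊ x∈a))) (isCovered c))) ,
          covered⇒<ω₂ (isCovered c)
      ; unbounded = λ {a} (H , ∣a∣) →
          let cs = λ {x} h → <ω₂⇒covered (H {x} (∊⇒∈ h))
              ca = <ω₂⇒covered ∣a∣ in
          Hull.N a cs ca , ⌊⌋⁺ {A = Closed (Hull.N a cs ca)} (Hull.N-closed a cs ca) ,
          λ z∈a → ∊⇒∈ (Hull.a⊆N a cs ca (∈⇒∊ z∈a))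
      ; closed    = λ D ∣D∣ (d , d∈D) cs _ → ⌊⌋⁺ {A = Closed (⋃ D)}
          (closed-⋃ {D} (<ω₂⇒covered ∣D∣) (∈⇒∊ d∈D)
          (λ {x} x∊D → ⌊⌋⁻ {A = Closed x} (cs (∊⇒∈ x∊D))))
      }

-- Names and the forcing relation

module Names (P : Poset 0ℓ 0ℓ 0ℓ) where
  open Poset P public using (_≤_) renaming (Carrier to Cond; refl to ≤-refl; trans to ≤-trans)
  open Forcing P public

  infix 3 _⊩_≐_ _⊩_∈_

  record _⊩_≐_ (p : Cond) (σ τ : Name) : Set where
    constructor ⟪_⟫
    field ⟪_⟫⁻¹ : forces-≐ σ τ p
  open _⊩_≐_ public

  record _⊩_∈_ (p : Cond) (σ τ : Name) : Set where
    constructor ⟪_⟫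
    field ⟪_⟫⁻¹ : forces-ε σ τ p
  open _⊩_∈_ public

  -- The shape of every forced membership, existential and disjunction. `_>>=_` chains such facts by
  -- passing to stronger and stronger conditions.
  Densely : (Cond → Set ℓ) → Cond → Set ℓ
  Densely Q p = ∀ q → q ≤ p → ∃[ r ] r ≤ q × Q r

  densely-mono : {Q : Cond → Set ℓ} → ∀ {p q} → q ≤ p → Densely Q p → Densely Q q
  densely-mono q≤p d r r≤q = d r (≤-trans r≤q q≤p)

  infixl 1 _>>=_

  _>>=_ : {Q : Cond → Set ℓ} {Q′ : Cond → Set ℓ′} → ∀ {p} → Densely Q p →
          (∀ {r} → r ≤ p → Q r → Densely Q′ r) → Densely Q′ p
  (d >>= f) q q≤p =
    let r , r≤q , Qr = d q q≤p
        s , s≤r , Q′s = f (≤-trans r≤q q≤p) Qr r ≤-refl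
    in s , ≤-trans s≤r r≤q , Q′s

  map-densely : {Q : Cond → Set ℓ} {Q′ : Cond → Set ℓ′} → ∀ {p} →
                (∀ {r} → r ≤ p → Q r → Q′ r) → Densely Q p → Densely Q′ p
  map-densely f d q q≤p = let r , r≤q , Qr = d q q≤p in r , r≤q , f (≤-trans r≤q q≤p) Qr

  Mono : (Cond → Set ℓ) → Set ℓ
  Mono φ = ∀ {p q} → q ≤ p → φ p → φ q

  now : {Q : Cond → Set ℓ} → Mono Q → ∀ {p} → Q p → Densely Q p
  now m Qp q q≤p = q , ≤-refl , m q≤p Qp

  dom : Name → Set
  dom (name I _ _) = I

  sub : ∀ τ → dom τ → Name
  sub (name _ τ _) = τ

  cond : ∀ τ → dom τ → Cond
  cond (name _ _ c) = c

  ∈-elim : ∀ {p σ τ} → p ⊩ σ ∈ τ →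
           Densely (λ r → Σ[ j ∈ dom τ ] r ≤ cond τ j × (r ⊩ σ ≐ sub τ j)) p
  ∈-elim {τ = name J τ d} ⟪ h ⟫ q q≤p = let r , r≤q , j , r≤d , e = h q q≤p in r , r≤q , j , r≤d , ⟪ e ⟫

  ∈-intro : ∀ {p σ τ} → Densely (λ r → Σ[ j ∈ dom τ ] r ≤ cond τ j × (r ⊩ σ ≐ sub τ j)) p →
            p ⊩ σ ∈ τ
  ∈-intro {τ = name J τ d} h =
    ⟪ (λ q q≤p → let r , r≤q , j , r≤d , ⟪ e ⟫ = h q q≤p in r , r≤q , j , r≤d , e) ⟫

  private
    ≐-refl′ : ∀ σ {p} → forces-≐ σ σ p
    ≐-refl′ (name I σ c) =
      (λ i q _ q≤c → q , ≤-refl , i , q≤c , ≐-refl′ (σ i)) ,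
      (λ i q _ q≤c → q , ≤-refl , i , q≤c , ≐-refl′ (σ i))

    ≐-sym′ : ∀ σ τ {p} → forces-≐ σ τ p → forces-≐ τ σ p
    ≐-sym′ (name I σ c) (name J τ d) (f , g) =
      (λ j q q≤p q≤d → let r , r≤q , i , r≤c , e = g j q q≤p q≤d in
                       r , r≤q , i , r≤c , ≐-sym′ (σ i) (τ j) e) ,
      (λ i q q≤p q≤c → let r , r≤q , j , r≤d , e = f i q q≤p q≤c in
                       r , r≤q , j , r≤d , ≐-sym′ (σ i) (τ j) e)

    ≐-mono′ : ∀ σ τ {p q} → q ≤ p → forces-≐ σ τ p → forces-≐ σ τ q
    ≐-mono′ (name _ _ _) (name _ _ _) q≤p (f , g) =
      (λ i r r≤q → f i r (≤-trans r≤q q≤p)) , (λ j r r≤q → g j r (≤-trans r≤q q≤p))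

    ≐-trans′ : ∀ σ τ ρ {p} → forces-≐ σ τ p → forces-≐ τ ρ p → forces-≐ σ ρ p
    ≐-trans′ (name I σ c) (name J τ d) (name K ρ e) (f , g) (f′ , g′) =
      (λ i q q≤p q≤c →
        let r , r≤q , j , r≤d , h = f i q q≤p q≤c
            s , s≤r , k , s≤e , h′ = f′ j r (≤-trans r≤q q≤p) r≤d
        in s , ≤-trans s≤r r≤q , k , s≤e ,
           ≐-trans′ (σ i) (τ j) (ρ k) (≐-mono′ (σ i) (τ j) s≤r h) h′) ,
      (λ k q q≤p q≤e →
        let r , r≤q , j , r≤d , h = g′ k q q≤p q≤e
            s , s≤r , i , s≤c , h′ = g j r (≤-trans r≤q q≤p) r≤d
        in s , ≤-trans s≤r r≤q , i , s≤c ,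
           ≐-trans′ (σ i) (τ j) (ρ k) h′ (≐-mono′ (τ j) (ρ k) s≤r h))

  ≐-refl : ∀ {p σ} → p ⊩ σ ≐ σ
  ≐-refl {σ = σ} = ⟪ ≐-refl′ σ ⟫

  ≐-sym : ∀ {p σ τ} → p ⊩ σ ≐ τ → p ⊩ τ ≐ σ
  ≐-sym {σ = σ} {τ} ⟪ e ⟫ = ⟪ ≐-sym′ σ τ e ⟫

  ≐-trans : ∀ {p σ τ ρ} → p ⊩ σ ≐ τ → p ⊩ τ ≐ ρ → p ⊩ σ ≐ ρ
  ≐-trans {σ = σ} {τ} {ρ} ⟪ e ⟫ ⟪ e′ ⟫ = ⟪ ≐-trans′ σ τ ρ e e′ ⟫

  ≐-mono : ∀ {σ τ} → Mono (_⊩ σ ≐ τ)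
  ≐-mono {σ} {τ} q≤p ⟪ e ⟫ = ⟪ ≐-mono′ σ τ q≤p e ⟫

  ∈-mono : ∀ {σ τ} → Mono (_⊩ σ ∈ τ)
  ∈-mono q≤p h = ∈-intro (densely-mono q≤p (∈-elim h))

  ∈-densely : ∀ {p σ τ} → Densely (_⊩ σ ∈ τ) p → p ⊩ σ ∈ τ
  ∈-densely d = ∈-intro (d >>= λ _ → ∈-elim)

  ∈-respˡ : ∀ {p σ σ′ τ} → p ⊩ σ ≐ σ′ → p ⊩ σ ∈ τ → p ⊩ σ′ ∈ τ
  ∈-respˡ e h = ∈-intro (map-densely
    (λ r≤p (j , r≤d , e′) → j , r≤d , ≐-trans (≐-sym (≐-mono r≤p e)) e′) (∈-elim h))

  private
    ≐-⊆ : ∀ {p σ τ} → p ⊩ σ ≐ τ → ∀ i → ∀ {q} → q ≤ p → q ≤ cond σ i → q ⊩ sub σ i ∈ τ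
    ≐-⊆ {σ = name _ σ _} {name _ _ _} ⟪ f , _ ⟫ i q≤p q≤c = ⟪ (λ r r≤q →
      f i r (≤-trans r≤q q≤p) (≤-trans r≤q q≤c)) ⟫

  ∈-respʳ : ∀ {p σ τ τ′} → p ⊩ τ ≐ τ′ → p ⊩ σ ∈ τ → p ⊩ σ ∈ τ′
  ∈-respʳ e h = ∈-densely (map-densely
    (λ r≤p (j , r≤d , e′) → ∈-respˡ (≐-sym e′) (≐-⊆ e j r≤p r≤d)) (∈-elim h))

  sub-∈ : ∀ {p} τ j → p ≤ cond τ j → p ⊩ sub τ j ∈ τ
  sub-∈ τ j p≤d = ∈-intro (λ q q≤p → q , ≤-refl , j , ≤-trans q≤p p≤d , ≐-refl)

  ≐-ext : ∀ {p σ τ} → (∀ {q ρ} → q ≤ p → q ⊩ ρ ∈ σ → q ⊩ ρ ∈ τ) →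
          (∀ {q ρ} → q ≤ p → q ⊩ ρ ∈ τ → q ⊩ ρ ∈ σ) → p ⊩ σ ≐ τ
  ≐-ext {σ = σ@(name _ σs _)} {τ@(name _ τs _)} f g = ⟪
    (λ i q q≤p q≤c → let r , r≤q , j , r≤d , ⟪ e ⟫ = ∈-elim (f q≤p (sub-∈ σ i q≤c)) q ≤-refl in
                     r , r≤q , j , r≤d , e) ,
    (λ j q q≤p q≤d → let r , r≤q , i , r≤c , e = ∈-elim (g q≤p (sub-∈ τ j q≤d)) q ≤-refl in
                     r , r≤q , i , r≤c , ⟪ ≐-sym e ⟫⁻¹) ⟫

  -- Names of ground model sets

  check-≅ : ∀ {p x y} → x ≅ y → p ⊩ check x ≐ check y
  check-≅ {x = x} {y} (≈⇒≅ e) = ⟪ go x y e ⟫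
    where
    go : ∀ x y {p} → x ≈ y → forces-≐ (check x) (check y) p
    go (sup A f) (sup B g) (l , r) =
      (λ (a , _) q _ q≤c → q , ≤-refl , (proj₁ (l a) , q) , ≤-refl , go (f a) _ (proj₂ (l a))) ,
      (λ (b , _) q _ q≤d → q , ≤-refl , (proj₁ (r b) , q) , ≤-refl , go _ (g b) (proj₂ (r b)))

  check-∊ : ∀ {p z x} → z ∊ x → p ⊩ check z ∈ check x
  check-∊ {x = x@(sup A f)} z∊x = ∈-intro (λ q _ → q , ≤-refl , (index z∊x , q) , ≤-refl ,
    check-≅ (≅-index z∊x))

  check-elim : ∀ {p σ x} → p ⊩ σ ∈ check x → Densely (λ r → ∃[ z ] z ∊ x × (r ⊩ σ ≐ check z)) p
  check-elim {x = x@(sup A f)} h = map-densely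
    (λ _ ((a , _) , _ , e) → f a , ∊-element x a , e) (∈-elim h)

  check-≅⁻ : ∀ {p x y} → p ⊩ check x ≐ check y → x ≅ y
  check-≅⁻ {x = x} {y} ⟪ e ⟫ = ≈⇒≅ (go x y e)
    where
    go : ∀ x y {p} → forces-≐ (check x) (check y) p → x ≈ y
    go (sup A f) (sup B g) {p} (l , r) =
      -- A check name contains each element paired with every condition, so p itself can serve as
      -- the second component.
      (λ a → let _ , _ , (b , _) , _ , e = l (a , p) p ≤-refl ≤-refl in b , go (f a) (g b) e) ,
      (λ b → let _ , _ , (a , _) , _ , e = r (b , p) p ≤-refl ≤-refl in a , go (f a) (g b) e)

  check-∊⁻ : ∀ {p z x} → p ⊩ check z ∈ check x → z ∊ x
  check-∊⁻ {p} h = let _ , _ , y , y∊x , e = check-elim h p ≤-refl in ∊-respˡ (≅-sym (check-≅⁻ e)) y∊x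

  -- Forced ordinals

  -- Quantifies over all names, whereas a formula read in `N` sees only names of elements of `N`. By
  -- `isTransitive⁺` and `isTransitive⁻` the two agree on names in the range of the quantifier.
  Transitiveᶠ : Name → Cond → Set₁
  Transitiveᶠ u p = ∀ {y z q} → q ≤ p → q ⊩ y ∈ u → q ⊩ z ∈ y → q ⊩ z ∈ u

  record Ordinalᶠ (u : Name) (p : Cond) : Set₁ where
    constructor ordinalᶠ
    field
      transitiveᶠ         : Transitiveᶠ u p
      elementsTransitiveᶠ : ∀ {y q} → q ≤ p → q ⊩ y ∈ u → Transitiveᶠ y q
  open Ordinalᶠ public

  Transitiveᶠ-mono : ∀ {u} → Mono (Transitiveᶠ u)
  Transitiveᶠ-mono q≤p t r≤q = t (≤-trans r≤q q≤p)

  Ordinalᶠ-mono : ∀ {u} → Mono (Ordinalᶠ u)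
  Ordinalᶠ-mono q≤p (ordinalᶠ t e) =
    ordinalᶠ (Transitiveᶠ-mono q≤p t) (λ r≤q → e (≤-trans r≤q q≤p))

  Ordinalᶠ-∈ : ∀ {u y p} → Ordinalᶠ u p → p ⊩ y ∈ u → Ordinalᶠ y p
  Ordinalᶠ-∈ (ordinalᶠ t e) h =
    ordinalᶠ (e ≤-refl h) (λ q≤p z∈y → e q≤p (t q≤p (∈-mono q≤p h) z∈y))

  Transitiveᶠ-resp : ∀ {u v p} → p ⊩ u ≐ v → Transitiveᶠ u p → Transitiveᶠ v p
  Transitiveᶠ-resp e t q≤p h h′ =
    ∈-respʳ (≐-mono q≤p e) (t q≤p (∈-respʳ (≐-sym (≐-mono q≤p e)) h) h′)

  Ordinalᶠ-resp : ∀ {u v p} → p ⊩ u ≐ v → Ordinalᶠ u p → Ordinalᶠ v p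
  Ordinalᶠ-resp e (ordinalᶠ t h) = ordinalᶠ (Transitiveᶠ-resp e t)
    (λ q≤p y∈v → h q≤p (∈-respʳ (≐-sym (≐-mono q≤p e)) y∈v))

  check-transitive : ∀ {x p} → IsTransitive x → Transitiveᶠ (check x) p
  check-transitive t q≤p y∈x z∈y = ∈-densely (check-elim y∈x >>= λ r≤q (y , y∊x , e) →
    map-densely (λ _ (z , z∊y , e′) → ∈-respˡ (≐-sym e′) (check-∊ (t z∊y y∊x)))
                (check-elim (∈-respʳ e (∈-mono r≤q z∈y))))

  Transitiveᶠ-densely : ∀ {u p} → Densely (Transitiveᶠ u) p → Transitiveᶠ u p
  Transitiveᶠ-densely d q≤p h h′ = ∈-densely (map-densely
    (λ r≤q t → t ≤-refl (∈-mono r≤q h) (∈-mono r≤q h′)) (densely-mono q≤p d))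

  check-ordinal : ∀ {x p} → IsOrdinal x → Ordinalᶠ (check x) p
  check-ordinal (ordinal t e) = ordinalᶠ (check-transitive t) λ q≤p y∈x →
    Transitiveᶠ-densely (map-densely {Q′ = Transitiveᶠ _} (λ _ (y , y∊x , e′) →
      Transitiveᶠ-resp (≐-sym e′) (check-transitive (e y∊x))) (check-elim y∈x))

  check-transitive⁻ : ∀ {x p} → Transitiveᶠ (check x) p → IsTransitive x
  check-transitive⁻ t z∊y y∊x = check-∊⁻ (t ≤-refl (check-∊ y∊x) (check-∊ z∊y))

  check-ordinal⁻ : ∀ {x p} → Ordinalᶠ (check x) p → IsOrdinal x
  check-ordinal⁻ (ordinalᶠ t e) = ordinal (check-transitive⁻ t)
    (λ y∊x → check-transitive⁻ (e ≤-refl (check-∊ y∊x)))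

-- Linearity of the ordinals in the extension

module Truth (em : ∀ {ℓ} → ExcludedMiddle ℓ) (ext : ∀ {a b} → Extensionality a b)
             (P : Poset 0ℓ 0ℓ 0ℓ) where
  open Choice em ext
  open Names P

  or-else-none : (Q : Cond → Set ℓ) (p : Cond) →
                 (∃[ r ] r ≤ p × Q r) ⊎ (∀ r → r ≤ p → ¬ Q r)
  or-else-none Q p with em {P = ∃[ r ] r ≤ p × Q r}
  ... | yes h = inj₁ h
  ... | no ¬h = inj₂ λ r r≤p Qr → ¬h (_ , r≤p , Qr)

  -- If no extension puts u into x, then by induction on x every β in x is forced into u. Either u
  -- is also included in x, and they are equal, or some element of u stays outside x. Descending
  -- through the structure of its name reaches such an element that is included in x; that one
  -- equals x, so x is in u.
  compareᶠ : ∀ {x u p} → IsOrdinal x → Ordinalᶠ u p →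
             Densely (λ r → (r ⊩ u ∈ check x) ⊎ (r ⊩ u ≐ check x) ⊎ (r ⊩ check x ∈ u)) p
  compareᶠ {x} = go (∊-wellFounded x)
    where
    go : ∀ {x u p} → Acc _∊_ x → IsOrdinal x → Ordinalᶠ u p →
         Densely (λ r → (r ⊩ u ∈ check x) ⊎ (r ⊩ u ≐ check x) ⊎ (r ⊩ check x ∈ u)) p
    go {x} {u} {p} (acc rs) ox ou q q≤p with or-else-none (_⊩ u ∈ check x) q
    ... | inj₁ (r , r≤q , h) = r , r≤q , inj₁ h
    ... | inj₂ u∉x           = split (or-else-none Stray q)
      where
      -- If a name v avoids x then no β ∈ x can be above it.
      x⊆ : ∀ {v r} → Ordinalᶠ v r → (∀ s → s ≤ r → ¬ (s ⊩ v ∈ check x)) →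
           ∀ {β} → β ∊ x → r ⊩ check β ∈ v
      x⊆ {v} ov v∉x {β} β∊x = ∈-densely (map-densely
        (λ { s≤r (inj₁ v∈β) → ⊥-elim (v∉x _ s≤r
               (check-transitive (transitive ox) ≤-refl (check-∊ β∊x) v∈β))
           ; s≤r (inj₂ (inj₁ v≐β)) → ⊥-elim (v∉x _ s≤r (∈-respˡ (≐-sym v≐β) (check-∊ β∊x)))
           ; _   (inj₂ (inj₂ β∈v)) → β∈v })
        (go (rs β∊x) (IsOrdinal-∊ ox β∊x) ov))

      Outside : Name → Cond → Set
      Outside y r = (r ⊩ y ∈ u) × (∀ s → s ≤ r → ¬ (s ⊩ y ∈ check x))

      Stray : Cond → Set₁
      Stray r = Σ[ y ∈ Name ] Outside y r

      ⊆x : ∀ {y r} → r ⊩ y ∈ u → (∀ s → s ≤ r → ¬ Outside y s) → r ⊩ y ∈ check x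
      ⊆x {y} y∈u ¬out = ∈-densely λ s s≤r → [ id , (λ none → ⊥-elim
        (¬out s s≤r (∈-mono s≤r y∈u , none))) ]′ (or-else-none (_⊩ y ∈ check x) s)

      -- Descend to a stray name all of whose elements lie in x; it equals x.
      x∈u : ∀ y {r} → r ≤ q → Outside y r → ∃[ s ] s ≤ r × (s ⊩ check x ∈ u)
      x∈u y@(name J τ d) {r} r≤q (y∈u , y∉x)
        with or-else-none (λ s → ∃[ j ] s ≤ d j × Outside (τ j) s) r
      ... | inj₁ (s , s≤r , j , _ , out) =
        let t , t≤s , h = x∈u (τ j) (≤-trans s≤r r≤q) out in t , ≤-trans t≤s s≤r , h
      ... | inj₂ none = r , ≤-refl , ∈-respˡ (≐-ext
            (λ s≤r z∈y → ∈-densely (map-densely (λ { t≤s (j , t≤d , e) →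
               let t≤r = ≤-trans t≤s s≤r in ∈-respˡ (≐-sym e) (⊆x
                 (transitiveᶠ ou (≤-trans t≤r (≤-trans r≤q q≤p)) (∈-mono t≤r y∈u) (sub-∈ y j t≤d))
                 (λ t′ t′≤t out → none t′ (≤-trans t′≤t t≤r) (j , ≤-trans t′≤t t≤d , out))) })
               (∈-elim z∈y)))
            (λ s≤r z∈x → ∈-densely (map-densely (λ { t≤s (β , β∊x , e) →
               ∈-respˡ (≐-sym e) (∈-mono (≤-trans t≤s s≤r) (x⊆ oy y∉x β∊x)) }) (check-elim z∈x))))
            y∈u
        where
        oy = Ordinalᶠ-∈ (Ordinalᶠ-mono (≤-trans r≤q q≤p) ou) y∈u

      split : (∃[ r ] r ≤ q × Stray r) ⊎ (∀ r → r ≤ q → ¬ Stray r) →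
              ∃[ r ] r ≤ q × ((r ⊩ u ∈ check x) ⊎ (r ⊩ u ≐ check x) ⊎ (r ⊩ check x ∈ u))
      split (inj₁ (r , r≤q , y , out)) =
        let s , s≤r , h = x∈u y r≤q out in s , ≤-trans s≤r r≤q , inj₂ (inj₂ h)
      split (inj₂ none) = q , ≤-refl , inj₂ (inj₁ (≐-ext
        (λ r≤q y∈u → ⊆x y∈u (λ s s≤r out → none s (≤-trans s≤r r≤q) (_ , out)))
        (λ r≤q z∈x → ∈-densely (map-densely (λ { s≤r (β , β∊x , e) → ∈-respˡ (≐-sym e)
           (∈-mono (≤-trans s≤r r≤q) (x⊆ (Ordinalᶠ-mono q≤p ou) u∉x β∊x)) }) (check-elim z∈x)))))

-- Formulas in the extension

module Semantics (em : ∀ {ℓ} → ExcludedMiddle ℓ) (ext : ∀ {a b} → Extensionality a b)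
                 (P : Poset 0ℓ 0ℓ 0ℓ) where
  open Choice em ext
  open Uncountable em ext
  open Names P
  open Truth em ext P

  -- The quantifier over all names, or over the names of elements of a set.
  record Quantifier : Set₃ where
    field
      All        : (Name → Cond → Set₁) → Cond → Set₁
      Range      : Name → Cond → Set
      Range-mono : ∀ {σ} → Mono (Range σ)
      elim       : ∀ {φ p σ} → All φ p → Range σ p → φ σ p
      intro      : ∀ {φ p} → (∀ {σ q} → q ≤ p → Range σ q → φ σ q) → All φ p
      All-mono   : ∀ {φ} → (∀ σ → Mono (φ σ)) → Mono (All φ)
      -- Closure under elements, together with ω₁, makes ordinals, ω and the natural numbers mean
      -- the same in both readings.
      Range-∈    : ∀ {σ τ p} → Range τ p → p ⊩ σ ∈ τ → Range σ p
      Range-ω₁   : ∀ {p} → Range (check ω₁) p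

  module Interpreted (𝒬 : Quantifier) where
    open Quantifier 𝒬 hiding (All)

    interpretation : Interpretation
    interpretation = record forcing { All = Quantifier.All 𝒬 }

    open Formulas interpretation public

    Range-∊ω₁ : ∀ {x p} → x ∊ ω₁ → Range (check x) p
    Range-∊ω₁ h = Range-∈ Range-ω₁ (check-∊ h)

    ω∊ω₁ : ω ∊ ω₁
    ω∊ω₁ = ∊ω₁⁺ ω-ordinal ω-countable

    Range-nat : ∀ n {p} → Range (check (nat n)) p
    Range-nat n = Range-∊ω₁ (transitive ω₁-ordinal (∊-element ω n) ω∊ω₁)

    ε⁺ : ∀ {p σ τ} → p ⊩ σ ∈ τ → (σ ε τ) p
    ε⁺ ⟪ h ⟫ = lift h

    ε⁻ : ∀ {p σ τ} → (σ ε τ) p → p ⊩ σ ∈ τ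
    ε⁻ (lift h) = ⟪ h ⟫

    ≐⁺ : ∀ {p σ τ} → p ⊩ σ ≐ τ → (σ ≐ τ) p
    ≐⁺ ⟪ h ⟫ = lift h

    ≐⁻ : ∀ {p σ τ} → (σ ≐ τ) p → p ⊩ σ ≐ τ
    ≐⁻ (lift h) = ⟪ h ⟫

    ⇒-mono : ∀ {φ ψ : Ω} → Mono (φ ⇒ ψ)
    ⇒-mono q≤p h r r≤q = h r (≤-trans r≤q q≤p)

    Ex-intro : ∀ {φ : Dom → Ω} {p} → Densely (λ r → Σ[ σ ∈ Name ] Range σ r × φ σ r) p → Ex φ p
    Ex-intro {φ} d q q≤p all = let r , r≤q , σ , R , h = d q q≤p in
      elim (All-mono (λ σ → ⇒-mono {φ σ} {ff}) r≤q all) R r ≤-refl h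

    Ex-elim : ∀ {φ : Dom → Ω} {p} → Ex φ p → Densely (λ r → Σ[ σ ∈ Name ] Range σ r × φ σ r) p
    Ex-elim {φ} h q q≤p with or-else-none (λ r → Σ[ σ ∈ Name ] Range σ r × φ σ r) q
    ... | inj₁ d    = d
    ... | inj₂ none = ⊥-elim (lower (h q q≤p
            (intro λ r≤q R s s≤r φs → lift (none s (≤-trans s≤r r≤q) (_ , Range-mono s≤r R , φs)))))

    Ex-mono : ∀ {φ : Dom → Ω} → Mono (Ex φ)
    Ex-mono q≤p h r r≤q = h r (≤-trans r≤q q≤p)

    ∨-intro : ∀ {φ ψ : Ω} {p} → Densely (λ r → φ r ⊎ ψ r) p → (φ ∨ ψ) p
    ∨-intro d q q≤p (¬φ , ¬ψ) with d q q≤p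
    ... | r , r≤q , inj₁ h = ¬φ r r≤q h
    ... | r , r≤q , inj₂ h = ¬ψ r r≤q h

    ∨-elim : ∀ {φ ψ : Ω} {p} → (φ ∨ ψ) p → Densely (λ r → φ r ⊎ ψ r) p
    ∨-elim {φ} {ψ} h q q≤p with or-else-none (λ r → φ r ⊎ ψ r) q
    ... | inj₁ d    = d
    ... | inj₂ none = ⊥-elim (lower (h q q≤p
            ( (λ r r≤q x → lift (none r r≤q (inj₁ x))) , (λ r r≤q x → lift (none r r≤q (inj₂ x))))))

    All-map : ∀ {φ ψ : Dom → Ω} {p} → (∀ σ → Mono (φ σ)) → (∀ {σ q} → q ≤ p → φ σ q → ψ σ q) →
              All φ p → All ψ p
    All-map m f h = intro λ q≤p R → f q≤p (elim (All-mono m q≤p h) R)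

    Ex-map : ∀ {φ ψ : Dom → Ω} {p} → (∀ {σ q} → q ≤ p → φ σ q → ψ σ q) → Ex φ p → Ex ψ p
    Ex-map f h = Ex-intro (map-densely (λ q≤p (σ , R , x) → σ , R , f q≤p x) (Ex-elim h))

    All∈-intro : ∀ {τ} {φ : Dom → Ω} {p} → (∀ {σ q} → q ≤ p → Range σ q → q ⊩ σ ∈ τ → φ σ q) →
                 (all[ x ε τ ] φ x) p
    All∈-intro f = intro λ q≤p R r r≤q h → f (≤-trans r≤q q≤p) (Range-mono r≤q R) (ε⁻ h)

    All∈-elim : ∀ {τ} {φ : Dom → Ω} {p} → (all[ x ε τ ] φ x) p →
                ∀ {σ q} → q ≤ p → Range σ q → q ⊩ σ ∈ τ → φ σ q
    All∈-elim {τ} {φ} h {q = q} q≤p R σ∈τ =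
      elim (All-mono (λ σ → ⇒-mono {σ ε τ} {φ σ}) q≤p h) R q ≤-refl (ε⁺ σ∈τ)

    All∈-mono : ∀ {τ} {φ : Dom → Ω} {p q} → q ≤ p → (all[ x ε τ ] φ x) p → (all[ x ε τ ] φ x) q
    All∈-mono {τ} {φ} = All-mono (λ σ → ⇒-mono {σ ε τ} {φ σ})

    Ex∈-intro : ∀ {τ} {φ : Dom → Ω} {p} →
                Densely (λ r → Σ[ σ ∈ Name ] Range σ r × (r ⊩ σ ∈ τ) × φ σ r) p →
                (ex[ x ε τ ] φ x) p
    Ex∈-intro d = Ex-intro (map-densely (λ _ (σ , R , h , x) → σ , R , ε⁺ h , x) d)

    Ex∈-elim : ∀ {τ} {φ : Dom → Ω} {p} → (ex[ x ε τ ] φ x) p →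
               Densely (λ r → Σ[ σ ∈ Name ] Range σ r × (r ⊩ σ ∈ τ) × φ σ r) p
    Ex∈-elim h = map-densely (λ _ (σ , R , h , x) → σ , R , ε⁻ h , x) (Ex-elim h)

    isTransitive⁺ : ∀ {u p} → Transitiveᶠ u p → isTransitive u p
    isTransitive⁺ t = All∈-intro λ q≤p _ y∈u → All∈-intro λ r≤q _ z∈y →
      ε⁺ (t (≤-trans r≤q q≤p) (∈-mono r≤q y∈u) z∈y)

    isTransitive⁻ : ∀ {u p} → Range u p → isTransitive u p → Transitiveᶠ u p
    isTransitive⁻ R t q≤p y∈u z∈y =
      let Ry = Range-∈ (Range-mono q≤p R) y∈u in
      ε⁻ (All∈-elim (All∈-elim t q≤p Ry y∈u) ≤-refl (Range-∈ Ry z∈y) z∈y)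

    isOrdinal⁺ : ∀ {u p} → Ordinalᶠ u p → isOrdinal u p
    isOrdinal⁺ (ordinalᶠ t e) =
      isTransitive⁺ t , All∈-intro λ q≤p _ y∈u → isTransitive⁺ (e q≤p y∈u)

    isOrdinal⁻ : ∀ {u p} → Range u p → isOrdinal u p → Ordinalᶠ u p
    isOrdinal⁻ R (t , e) = ordinalᶠ (isTransitive⁻ R t) λ q≤p y∈u →
      let Ry = Range-∈ (Range-mono q≤p R) y∈u in isTransitive⁻ Ry (All∈-elim e q≤p Ry y∈u)

    isSuccessor⁺ : ∀ {x y z p} → p ⊩ y ≐ check x → p ⊩ z ≐ check (succ x) → isSuccessor z y p
    isSuccessor⁺ y≐ z≐ = intro λ {u} q≤p _ →
      (λ r r≤q u∈z → let r≤p = ≤-trans r≤q q≤p in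
        ∨-intro (map-densely (λ { s≤r (v , v∊s , u≐v) → [
            (λ v∊x → inj₁ (ε⁺ (∈-respʳ (≐-sym (≐-mono (≤-trans s≤r r≤p) y≐))
                                 (∈-respˡ (≐-sym u≐v) (check-∊ v∊x))))) ,
            (λ v≅x → inj₂ (≐⁺ (≐-trans u≐v (≐-trans (check-≅ v≅x)
                                 (≐-sym (≐-mono (≤-trans s≤r r≤p) y≐)))))) ]′ (succ⁻ v∊s) })
          (check-elim (∈-respʳ (≐-mono r≤p z≐) (ε⁻ u∈z))))) ,
      (λ r r≤q h → let r≤p = ≤-trans r≤q q≤p in
        ε⁺ (∈-respʳ (≐-sym (≐-mono r≤p z≐)) (∈-densely (map-densely (λ
          { s≤r (inj₁ u∈y) → ∈-densely (map-densely (λ _ (v , v∊x , u≐v) →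
              ∈-respˡ (≐-sym u≐v) (check-∊ (succ⁺ v∊x)))
              (check-elim (∈-respʳ (≐-mono (≤-trans s≤r r≤p) y≐) (ε⁻ u∈y))))
          ; s≤r (inj₂ u≐y) → ∈-respˡ (≐-sym (≐-trans (≐⁻ u≐y) (≐-mono (≤-trans s≤r r≤p) y≐)))
              (check-∊ (∊-succ _)) }) (∨-elim {u ε _} {u ≐ _} h)))))

    isSuccessor-∈ : ∀ {y z p} → Range y p → isSuccessor z y p → p ⊩ y ∈ z
    isSuccessor-∈ {y} {z} R h = ε⁻ (proj₂ (elim h R) _ ≤-refl
      (∨-intro {y ε y} {y ≐ y} (now (λ { r≤q (inj₁ x) → inj₁ (ε⁺ (∈-mono r≤q (ε⁻ x)))
                         ; r≤q (inj₂ x) → inj₂ (≐⁺ (≐-mono r≤q (≐⁻ x))) })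
                      (inj₂ (≐⁺ ≐-refl)))))

    isLimit-ω : ∀ {p} → isLimit (check ω) p
    isLimit-ω =
      isOrdinal⁺ (check-ordinal ω-ordinal) ,
      Ex-intro (λ q _ → q , ≤-refl , check ∅ , Range-nat 0 , ε⁺ (check-∊ (∊-element ω 0))) ,
      All∈-intro λ q≤p _ y∈ω → Ex∈-intro (map-densely (λ { _ (x , x∊ω , y≐x) →
        let n = index x∊ω in
        check (nat (suc n)) , Range-nat (suc n) , check-∊ (∊-element ω (suc n)) ,
        isSuccessor⁺ (≐-trans y≐x (check-≅ (≅-index x∊ω))) ≐-refl }) (check-elim y∈ω))

    ¬isLimit-nat : ∀ n {y p} → p ⊩ y ≐ check (nat n) → ¬ isLimit y p
    ¬isLimit-nat zero {p = p} y≐ (_ , ne , _) =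
      let q , q≤p , z , _ , z∈y = Ex-elim ne p ≤-refl
          _ , _ , _ , z∊∅ , _ = check-elim (∈-respʳ (≐-mono q≤p y≐) (ε⁻ z∈y)) q ≤-refl
      in ⊥-elim (index z∊∅)
    ¬isLimit-nat (suc n) {p = p} y≐ (_ , _ , lim) =
      let n∈y = ∈-respʳ (≐-sym y≐) (check-∊ (∊-succ (nat n)))
          q , q≤p , z , _ , z∈y , s = Ex∈-elim (All∈-elim lim ≤-refl (Range-nat n) n∈y) p ≤-refl
          r , r≤q , x , x∊ , z≐x = check-elim (∈-respʳ (≐-mono q≤p y≐) z∈y) q ≤-refl
          n∊x = check-∊⁻ (∈-respʳ z≐x (∈-mono r≤q (isSuccessor-∈ (Range-nat n) s)))
      in [ ∊-asym n∊x , (λ x≅n → ∊-irrefl (≅-sym x≅n) n∊x) ]′ (succ⁻ x∊)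

    isω-ω : ∀ {p} → isω (check ω) p
    isω-ω = isLimit-ω , All∈-intro λ q≤p _ y∈ω r r≤q lim →
      let s , s≤r , x , x∊ω , y≐x = check-elim (∈-mono r≤q y∈ω) r ≤-refl
      in lift (¬isLimit-nat (index x∊ω) (≐-trans y≐x (check-≅ (≅-index x∊ω))) (mono s≤r lim))
      where
      mono : ∀ {x p q} → q ≤ p → isLimit x p → isLimit x q
      mono r≤q ((t , e) , ne , lim) =
        (All∈-mono r≤q t , All∈-mono r≤q e) , Ex-mono r≤q ne , All∈-mono r≤q lim

    -- By `compareᶠ`, either w is included in ω or ω is an element of w. The latter would be a limit
    -- inside w, which `least` forbids.
    ω-elements : ∀ {w p} → Range w p → isω w p → ∀ {y q} → q ≤ p → q ⊩ y ∈ w →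
                 Densely (λ r → ∃[ n ] (r ⊩ y ≐ check (nat n))) q
    ω-elements {w} R ((o , _) , least) q≤p y∈w =
      densely-mono q≤p (compareᶠ ω-ordinal (isOrdinal⁻ R o)) >>= λ
        { r≤q (inj₁ w∈ω) → natural
            (check-transitive (transitive ω-ordinal) ≤-refl w∈ω (∈-mono r≤q y∈w))
        ; r≤q (inj₂ (inj₁ w≐ω)) → natural (∈-respʳ w≐ω (∈-mono r≤q y∈w))
        ; {r} r≤q (inj₂ (inj₂ ω∈w)) → ⊥-elim (lower (All∈-elim least (≤-trans r≤q q≤p)
            (Range-∊ω₁ ω∊ω₁) ω∈w r ≤-refl isLimit-ω)) }
      where
      natural : ∀ {y q} → q ⊩ y ∈ check ω → Densely (λ r → ∃[ n ] (r ⊩ y ≐ check (nat n))) q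
      natural h = map-densely
        (λ _ (x , x∊ω , e) → index x∊ω , ≐-trans e (check-≅ (≅-index x∊ω))) (check-elim h)

    -- Forced injections into ω and the chain condition

    infix 7 _[_]↦_

    _[_]↦_ : Name → Name → Name → Ω
    x [ f ]↦ y = ex[ z ε f ] isOrderedPair z x y

    isPair-cong : ∀ {z x y y′ p} → p ⊩ y ≐ y′ → isPair z x y p → isPair z x y′ p
    isPair-cong {z} {x} {y} {y′} y≐ = All-map
      {λ w → (w ε z ⇒ w ≐ x ∨ w ≐ y) ∧ (w ≐ x ∨ w ≐ y ⇒ w ε z)}
      (λ w q≤p (l , r) → ⇒-mono {w ε z} {w ≐ x ∨ w ≐ y} q≤p l
                       , ⇒-mono {w ≐ x ∨ w ≐ y} {w ε z} q≤p r)
      (λ q≤p (l , r) →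
        (λ s s≤q h → change (≐-mono (≤-trans s≤q q≤p) y≐) (l s s≤q h)) ,
        (λ s s≤q h → r s s≤q (change (≐-sym (≐-mono (≤-trans s≤q q≤p) y≐)) h)))
      where
      change : ∀ {w y y′ p} → p ⊩ y ≐ y′ → (w ≐ x ∨ w ≐ y) p → (w ≐ x ∨ w ≐ y′) p
      change {w} {y} y≐ h = ∨-intro (map-densely
        (λ { _ (inj₁ e) → inj₁ e ; r≤ (inj₂ e) → inj₂ (≐⁺ (≐-trans (≐⁻ e) (≐-mono r≤ y≐))) })
        (∨-elim {w ≐ x} {w ≐ y} h))

    ↦-cong : ∀ {f x y y′ p} → p ⊩ y ≐ y′ → (x [ f ]↦ y) p → (x [ f ]↦ y′) p
    ↦-cong y≐ = Ex-map λ q≤p (z∈f , h) → z∈f , Ex-map (λ r≤q → Ex-map λ s≤r (a , b , c) →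
      a , isPair-cong (≐-mono (≤-trans s≤r (≤-trans r≤q q≤p)) y≐) b , c) h

    isCountable-mono : ∀ {σ} → Mono (isCountable σ)
    isCountable-mono q≤p h r r≤q = h r (≤-trans r≤q q≤p)

    -- Antichains are indexed families, so what is counted is the indices and conditions need not be
    -- compared for equality.
    CountableChainCondition : Set₁
    CountableChainCondition = ∀ {A : Set} (Q : Pred A 0ℓ) (q : A → Cond) →
      (∀ {i j r} → Q i → Q j → r ≤ q i → r ≤ q j → i ≡ j) → CountablyMany _≡_ Q

    -- For each k in a, some condition decides the value n of the forced injection at k. A common
    -- extension of the conditions of k and l with the same n would force k = l, so by the chain
    -- condition each n is taken countably often.
    isCountable⇒countable : CountableChainCondition → ∀ {a σ p} → p ⊩ σ ≐ check a →
                            isCountable σ p → CountablyMany _≡_ (λ k → ⌜ k ⌝ ∊ a)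
    isCountable⇒countable ccc {a} {σ} {p} σ≐ h =
      let q , q≤p , w , Rw , isω-w , exf = Ex-elim h p ≤-refl
          r , r≤q , f , Rf , inj = Ex-elim exf q ≤-refl
      in conclude isω-w Rw r≤q (≐-mono (≤-trans r≤q q≤p) σ≐) inj
      where
      conclude : ∀ {w f q r} → isω w q → Range w q → r ≤ q → r ⊩ σ ≐ check a →
                 isInjection f σ w r → CountablyMany _≡_ (λ k → ⌜ k ⌝ ∊ a)
      conclude {w} {f} {q} {r} isω-w Rw r≤q σ≐ (_ , total , _ , injective) =
        countablyMany-∪ {Q = λ n k → (⌜ k ⌝ ∊ a) × value k ≡ n} (λ h → _ , h , refl)
          (λ n → ccc (λ k → (⌜ k ⌝ ∊ a) × value k ≡ n) witness compatible)
        where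
        Decides : K → Set₁
        Decides k = Σ[ s ∈ Cond ] s ≤ r × Σ[ n ∈ ℕ ] (check ⌜ k ⌝ [ f ]↦ check (nat n)) s

        decides : ∀ k → ⌜ k ⌝ ∊ a → Decides k
        decides k k∊a =
          let s , s≤r , y , _ , y∈w , m = Ex∈-elim (All∈-elim total ≤-refl (Range-∊ω₁ (⌜⌝∊ω₁ k))
                                            (∈-respʳ (≐-sym σ≐) (check-∊ k∊a))) r ≤-refl
              t , t≤s , n , y≐n = ω-elements Rw isω-w (≤-trans s≤r r≤q) y∈w s ≤-refl
          in t , ≤-trans t≤s s≤r , n , ↦-cong y≐n (Ex-mono t≤s m)

        -- The default outside a only makes the choice total; it is read only together with a proof
        -- that k is in a.
        decide : ∀ k → Dec (⌜ k ⌝ ∊ a) → Cond × ℕ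
        decide k (yes h) = let s , _ , n , _ = decides k h in s , n
        decide k (no _)  = r , 0

        witness : K → Cond
        witness k = proj₁ (decide k em)

        value : K → ℕ
        value k = proj₂ (decide k em)

        decide-↦ : ∀ k (d : Dec (⌜ k ⌝ ∊ a)) → ⌜ k ⌝ ∊ a → let s , n = decide k d in
                   s ≤ r × (check ⌜ k ⌝ [ f ]↦ check (nat n)) s
        decide-↦ k (yes h) _ = let _ , s≤r , _ , m = decides k h in s≤r , m
        decide-↦ k (no ¬h) h = ⊥-elim (¬h h)

        compatible : ∀ {n k l t} → (⌜ k ⌝ ∊ a) × value k ≡ n → (⌜ l ⌝ ∊ a) × value l ≡ n →
                     t ≤ witness k → t ≤ witness l → k ≡ l
        compatible {n} {k} {l} {t} (k∊a , refl) (l∊a , e) t≤k t≤l =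
          let s≤r , mk = decide-↦ k em k∊a
              _ , ml = decide-↦ l em l∊a
              x = check ⌜ k ⌝ ; x′ = check ⌜ l ⌝ ; y = check (nat (value k))
              φ : Dom → Dom → Dom → Ω
              φ x x′ y = x [ f ]↦ y ∧ x′ [ f ]↦ y ⇒ x ≐ x′
              inj = All-mono (λ x → All-mono (λ x′ → All-mono (λ y →
                      ⇒-mono {x [ f ]↦ y ∧ x′ [ f ]↦ y} {x ≐ x′}))) (≤-trans t≤k s≤r) injective
          in ⌜⌝-injective (check-≅⁻ (≐⁻ (elim (elim (elim {λ x → All λ x′ → All λ y → φ x x′ y} inj
               (Range-∊ω₁ (⌜⌝∊ω₁ k))) (Range-∊ω₁ (⌜⌝∊ω₁ l))) (Range-nat (value k))
               t ≤-refl (Ex-mono t≤k mk ,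
                 ↦-cong (check-≅ (subst (λ m → nat m ≅ nat (value k)) (sym e) ≅-refl))
                        (Ex-mono t≤l ml)))))

-- Preservation of ω₁

unorderedPair orderedPair : V → V → V
unorderedPair x y = sup Bool (λ b → if b then x else y)
orderedPair x y = unorderedPair (unorderedPair x x) (unorderedPair x y)

unorderedPair⁻ : ∀ {x y z} → z ∊ unorderedPair x y → z ≅ x ⊎ z ≅ y
unorderedPair⁻ (∈⇒∊ (true  , p)) = inj₁ (≈⇒≅ p)
unorderedPair⁻ (∈⇒∊ (false , p)) = inj₂ (≈⇒≅ p)

module ω₁-Preservation (em : ∀ {ℓ} → ExcludedMiddle ℓ) (ext : ∀ {a b} → Extensionality a b)
                       (P : Poset 0ℓ 0ℓ 0ℓ) where
  open Choice em ext
  open Uncountable em ext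
  open Names P
  open Semantics em ext P

  unbounded : Quantifier
  unbounded = record
    { All        = λ φ p → ∀ σ → φ σ p
    ; Range      = λ _ _ → ⊤
    ; Range-mono = λ _ _ → tt
    ; elim       = λ h _ → h _
    ; intro      = λ h σ → h ≤-refl tt
    ; All-mono   = λ m q≤p h σ → m σ q≤p (h σ)
    ; Range-∈    = λ _ _ → tt
    ; Range-ω₁   = tt
    }

  open Interpreted unbounded

  -- The names of elements of N, over which the formulas "N ⊨ φ" quantify.
  boundedBy : (N : V) → IsTransitive N → ω₁ ∊ N → Quantifier
  boundedBy N t ω₁∊N = record
    { All        = λ φ p → ∀ σ q → q ≤ p → Lift (lsuc 0ℓ) (forces-ε σ (check N) q) → φ σ q
    ; Range      = λ σ p → p ⊩ σ ∈ check N
    ; Range-mono = ∈-mono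
    ; elim       = λ { h ⟪ σ∈N ⟫ → h _ _ ≤-refl (lift σ∈N) }
    ; intro      = λ { h σ q q≤p (lift σ∈N) → h q≤p ⟪ σ∈N ⟫ }
    ; All-mono   = λ m q≤p h σ r r≤q σ∈N → h σ r (≤-trans r≤q q≤p) σ∈N
    ; Range-∈    = λ τ∈N σ∈τ → check-transitive t ≤-refl τ∈N σ∈τ
    ; Range-ω₁   = check-∊ ω₁∊N
    }

  isPair⁺ : ∀ {a b x y z p} → p ⊩ x ≐ check a → p ⊩ y ≐ check b →
            p ⊩ z ≐ check (unorderedPair a b) → isPair z x y p
  isPair⁺ x≐ y≐ z≐ w =
    (λ r r≤p w∈z → ∨-intro (map-densely (λ s≤r (c , c∊ , w≐c) → let s≤p = ≤-trans s≤r r≤p in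
      [ (λ c≅a → inj₁ (≐⁺ (≐-trans w≐c (≐-trans (check-≅ c≅a) (≐-sym (≐-mono s≤p x≐))))))
      , (λ c≅b → inj₂ (≐⁺ (≐-trans w≐c (≐-trans (check-≅ c≅b) (≐-sym (≐-mono s≤p y≐)))))) ]′
      (unorderedPair⁻ c∊)) (check-elim (∈-respʳ (≐-mono r≤p z≐) (ε⁻ w∈z))))) ,
    (λ r r≤p h → ε⁺ (∈-respʳ (≐-sym (≐-mono r≤p z≐)) (∈-densely (map-densely (λ
      { s≤r (inj₁ e) → ∈-respˡ (≐-sym (≐-trans (≐⁻ e) (≐-mono (≤-trans s≤r r≤p) x≐)))
                               (check-∊ (∊-intro true ≅-refl))
      ; s≤r (inj₂ e) → ∈-respˡ (≐-sym (≐-trans (≐⁻ e) (≐-mono (≤-trans s≤r r≤p) y≐)))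
                               (check-∊ (∊-intro false ≅-refl)) })
      (∨-elim {w ≐ _} {w ≐ _} h)))))

  isPair-∈ˡ : ∀ {x y z p} → isPair z x y p → p ⊩ x ∈ z
  isPair-∈ˡ {x} {y} {p = p} h = ε⁻ (proj₂ (h x) p ≤-refl
    (∨-intro {x ≐ x} {x ≐ y} (λ q _ → q , ≤-refl , inj₁ (≐⁺ ≐-refl))))

  isPair-∈ʳ : ∀ {x y z p} → isPair z x y p → p ⊩ y ∈ z
  isPair-∈ʳ {x} {y} {p = p} h = ε⁻ (proj₂ (h y) p ≤-refl
    (∨-intro {y ≐ x} {y ≐ y} (λ q _ → q , ≤-refl , inj₂ (≐⁺ ≐-refl))))

  isPair⁻ : ∀ {x y z w p} → isPair z x y p → p ⊩ w ∈ z →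
            Densely (λ r → (r ⊩ w ≐ x) ⊎ (r ⊩ w ≐ y)) p
  isPair⁻ {x} {y} {z} {w} {p} h w∈z = map-densely
    (λ { _ (inj₁ e) → inj₁ (≐⁻ e) ; _ (inj₂ e) → inj₂ (≐⁻ e) })
    (∨-elim {w ≐ x} {w ≐ y} (proj₁ (h w) p ≤-refl (ε⁺ w∈z)))

  isPair-mono : ∀ {x y z} → Mono (isPair z x y)
  isPair-mono q≤p h w = (λ r r≤q → proj₁ (h w) r (≤-trans r≤q q≤p)) ,
                        (λ r r≤q → proj₂ (h w) r (≤-trans r≤q q≤p))

  check-pair⁻ : ∀ {a b w p} → p ⊩ w ∈ check (unorderedPair a b) →
                Densely (λ r → (r ⊩ w ≐ check a) ⊎ (r ⊩ w ≐ check b)) p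
  check-pair⁻ h = map-densely (λ _ (c , c∊ , w≐c) →
    [ (λ e → inj₁ (≐-trans w≐c (check-≅ e))) , (λ e → inj₂ (≐-trans w≐c (check-≅ e))) ]′
    (unorderedPair⁻ c∊)) (check-elim h)

  check-pairˡ : ∀ {a b p} → p ⊩ check a ∈ check (unorderedPair a b)
  check-pairˡ = check-∊ (∊-intro true ≅-refl)

  check-pairʳ : ∀ {a b p} → p ⊩ check b ∈ check (unorderedPair a b)
  check-pairʳ = check-∊ (∊-intro false ≅-refl)

  ≐-densely : ∀ {σ τ p} → Densely (_⊩ σ ≐ τ) p → p ⊩ σ ≐ τ
  ≐-densely d = ≐-ext
    (λ q≤p h → ∈-densely (map-densely (λ r≤q e → ∈-respʳ e (∈-mono r≤q h)) (densely-mono q≤p d)))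
    (λ q≤p h → ∈-densely (map-densely (λ r≤q e → ∈-respʳ (≐-sym e) (∈-mono r≤q h))
                                      (densely-mono q≤p d)))

  isOrderedPair⁺ : ∀ {a b x y z p} → p ⊩ x ≐ check a → p ⊩ y ≐ check b →
                   p ⊩ z ≐ check (orderedPair a b) → isOrderedPair z x y p
  isOrderedPair⁺ x≐ y≐ z≐ = Ex-intro λ q q≤p → q , ≤-refl , _ , tt , Ex-intro λ r r≤q →
    let r≤p = ≤-trans r≤q q≤p in r , ≤-refl , _ , tt ,
    isPair⁺ (≐-mono r≤p x≐) (≐-mono r≤p x≐) ≐-refl ,
    isPair⁺ (≐-mono r≤p x≐) (≐-mono r≤p y≐) ≐-refl ,
    isPair⁺ ≐-refl ≐-refl (≐-mono r≤p z≐)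

  -- Kuratowski's argument with dense case splits. In the degenerate case y = a, the element b of
  -- the second component must be x or y, and x = a gives y = b either way.
  isOrderedPair⁻ : ∀ {a b x y z p} → isOrderedPair z x y p → p ⊩ z ≐ check (orderedPair a b) →
                   (p ⊩ x ≐ check a) × (p ⊩ y ≐ check b)
  isOrderedPair⁻ {a} {b} {x} {y} {z} h z≐ =
    ≐-densely (map-densely (λ _ → proj₁) components) ,
    ≐-densely (map-densely (λ _ → proj₂) components)
    where
    A = unorderedPair a a
    B = unorderedPair a b

    compute : ∀ {u v r} → isPair u x x r → isPair v x y r → isPair z u v r →
              r ⊩ z ≐ check (orderedPair a b) → (r ⊩ x ≐ check a) × (r ⊩ y ≐ check b)
    compute {u} {v} {r} hu hv hz z≐ = x≐a , ≐-densely (y-cases >>= λ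
      { s≤r (inj₁ y≐a) → map-densely (λ
          { t≤s (inj₁ b≐x) → let t≤r = ≤-trans t≤s s≤r in ≐-trans (≐-mono t≤s y≐a)
              (≐-sym (≐-trans b≐x (≐-mono t≤r x≐a)))
          ; t≤s (inj₂ b≐y) → ≐-sym b≐y }) (densely-mono s≤r b-cases)
      ; s≤r (inj₂ y≐b) → now ≐-mono y≐b })
      where
      x≐a : r ⊩ x ≐ check a
      x≐a = ≐-densely (isPair⁻ hz (∈-respʳ (≐-sym z≐) (check-pairˡ {A} {B})) >>= λ
        { s≤r (inj₁ A≐u) → in-A (∈-respʳ (≐-sym A≐u) (∈-mono s≤r (isPair-∈ˡ {x} {x} hu)))
        ; s≤r (inj₂ A≐v) → in-A (∈-respʳ (≐-sym A≐v) (∈-mono s≤r (isPair-∈ˡ {x} {y} hv))) })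
        where
        in-A : ∀ {w s} → s ⊩ w ∈ check A → Densely (_⊩ w ≐ check a) s
        in-A w∈A = map-densely (λ { _ (inj₁ e) → e ; _ (inj₂ e) → e }) (check-pair⁻ w∈A)

      y-cases : Densely (λ s → (s ⊩ y ≐ check a) ⊎ (s ⊩ y ≐ check b)) r
      y-cases = check-pair⁻ {A} {B} (∈-respʳ z≐ (isPair-∈ʳ {u} {v} hz)) >>= λ
        { s≤r (inj₁ v≐A) → map-densely (λ { _ (inj₁ e) → inj₁ e ; _ (inj₂ e) → inj₁ e })
                             (check-pair⁻ (∈-respʳ v≐A (∈-mono s≤r (isPair-∈ʳ {x} {y} hv))))
        ; s≤r (inj₂ v≐B) → check-pair⁻ (∈-respʳ v≐B (∈-mono s≤r (isPair-∈ʳ {x} {y} hv))) }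

      b-cases : Densely (λ s → (s ⊩ check b ≐ x) ⊎ (s ⊩ check b ≐ y)) r
      b-cases = isPair⁻ hz (∈-respʳ (≐-sym z≐) (check-pairʳ {A} {B})) >>= λ
        { s≤r (inj₁ B≐u) → map-densely (λ { _ (inj₁ e) → inj₁ e ; _ (inj₂ e) → inj₁ e })
            (isPair⁻ {x} {x} (isPair-mono {x} {x} {u} s≤r hu) (∈-respʳ B≐u (check-pairʳ {a} {b})))
        ; s≤r (inj₂ B≐v) →
            isPair⁻ {x} {y} (isPair-mono {x} {y} {v} s≤r hv) (∈-respʳ B≐v (check-pairʳ {a} {b})) }

    components : Densely (λ r → (r ⊩ x ≐ check a) × (r ⊩ y ≐ check b)) _
    components = Ex-elim h >>= λ r≤p (u , _ , ex) → map-densely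
      (λ s≤r (v , _ , hu , hv , hz) → compute hu hv hz (≐-mono (≤-trans s≤r r≤p) z≐)) (Ex-elim ex)

  isCountable-check : ∀ {a σ p} → CountableSet a → p ⊩ σ ≐ check a → isCountable σ p
  isCountable-check {a} {σ} c σ≐ = Ex-intro λ q q≤p → q , ≤-refl , check ω , tt , isω-ω ,
    Ex-intro λ r r≤q → r , ≤-refl , check F , tt , injection-F (≐-mono (≤-trans r≤q q≤p) σ≐)
    where
    open Representatives (Elements a) using (rep; rep-≈; rep-cong)

    -- Codes may differ between indices of the same element; the representative makes the number
    -- depend on the element alone, so that `F` is single-valued.
    number-of : Index a → ℕ
    number-of i = code c _ (∊-element a (rep i))

    F : V
    F = sup (Index a) (λ i → orderedPair (element a i) (nat (number-of i)))

    Entry : Name → Name → Cond → Set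
    Entry x y r =
      Σ[ i ∈ Index a ] (r ⊩ x ≐ check (element a i)) × (r ⊩ y ≐ check (nat (number-of i)))

    entry⁺ : ∀ {x y} → Mono (Entry x y)
    entry⁺ q≤p (i , d , e) = i , ≐-mono q≤p d , ≐-mono q≤p e

    ↦⁻ : ∀ {x y p} → (x [ check F ]↦ y) p → Densely (Entry x y) p
    ↦⁻ {x} {y} h = Ex∈-elim h >>= λ r≤p (z , _ , z∈F , o) →
      check-elim {x = F} z∈F >>= λ s≤r (w , w∊F , z≐w) →
      let d , e = isOrderedPair⁻ (Ex-mono s≤r o) (≐-trans z≐w (check-≅ (≅-index w∊F)))
      in now (entry⁺ {x} {y}) (index w∊F , d , e)

    ↦⁺ : ∀ {x y p} → Entry x y p → (x [ check F ]↦ y) p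
    ↦⁺ (i , d , e) = Ex∈-intro λ q q≤p → q , ≤-refl , _ , tt , check-∊ (∊-element F i) ,
      isOrderedPair⁺ (≐-mono q≤p d) (≐-mono q≤p e) ≐-refl

    injection-F : ∀ {r} → r ⊩ σ ≐ check a → isInjection (check F) σ (check ω) r
    injection-F σ≐ =
      All∈-intro (λ q≤r _ z∈F → Ex∈-intro (check-elim {x = F} z∈F >>= λ s≤q (w , w∊F , z≐w) →
        let i = index w∊F in
        λ t t≤s → let t≤r = ≤-trans t≤s (≤-trans s≤q q≤r) in
        t , ≤-refl , check (element a i) , tt ,
        ∈-respʳ (≐-sym (≐-mono t≤r σ≐)) (check-∊ (∊-element a i)) ,
        Ex∈-intro λ u u≤t → u , ≤-refl , check (nat (number-of i)) , tt ,
        check-∊ (∊-element ω (number-of i)) ,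
        isOrderedPair⁺ ≐-refl ≐-refl (≐-mono (≤-trans u≤t t≤s)
          (≐-trans z≐w (check-≅ (≅-index w∊F)))))) ,
      All∈-intro (λ q≤r _ x∈σ → Ex∈-intro (map-densely (λ s≤q (w , w∊a , x≐w) →
        let i = index w∊a in
        check (nat (number-of i)) , tt , check-∊ (∊-element ω (number-of i)) ,
        ↦⁺ (i , ≐-trans x≐w (check-≅ (≅-index w∊a)) , ≐-refl))
        (check-elim (∈-respʳ (≐-mono q≤r σ≐) x∈σ)))) ,
      (λ x y y′ q q≤r (h , h′) → ≐⁺ (≐-densely (↦⁻ h >>= λ s≤q (i , x≐i , y≐i) →
        map-densely (λ t≤s (j , x≐j , y′≐j) → ≐-trans (≐-mono t≤s y≐i) (≐-trans
          (check-≅ (same-number (check-≅⁻ (≐-trans (≐-sym (≐-mono t≤s x≐i)) x≐j)))) (≐-sym y′≐j)))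
          (↦⁻ (Ex-mono s≤q h′))))) ,
      (λ x x′ y q q≤r (h , h′) → ≐⁺ (≐-densely (↦⁻ h >>= λ s≤q (i , x≐i , y≐i) →
        map-densely (λ t≤s (j , x′≐j , y≐j) → ≐-trans (≐-mono t≤s x≐i) (≐-trans
          (check-≅ (same-element (check-≅⁻ (≐-trans (≐-sym (≐-mono t≤s y≐i)) y≐j)))) (≐-sym x′≐j)))
          (↦⁻ (Ex-mono s≤q h′)))))
      where
      same-number : ∀ {i j} → element a i ≅ element a j → nat (number-of i) ≅ nat (number-of j)
      same-number {i} {j} (≈⇒≅ e) = subst (λ k → nat (code c _ (∊-element a (rep i))) ≅
        nat (code c _ (∊-element a k))) (rep-cong {i} {j} e) ≅-refl

      same-element : ∀ {i j} → nat (number-of i) ≅ nat (number-of j) → element a i ≅ element a j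
      same-element {i} {j} e = ≅-trans (≈⇒≅ (rep-≈ i)) (≅-trans
        (code-injective c (∊-element a (rep i)) (∊-element a (rep j)) (nat-injective e))
        (≅-sym (≈⇒≅ (rep-≈ j))))

  -- A forced injection of ω₁ into ω would make `K` countable by the chain condition. The elements
  -- of ω₁ stay countable because their injections in the ground model survive.
  preserves-ω₁ : CountableChainCondition → Preserves-ω₁
  preserves-ω₁ ccc p =
    isOrdinal⁺ (check-ordinal ω₁-ordinal) ,
    (λ q _ h → lift (K-uncountable (countablyMany-⊆ (λ {k} _ → ⌜⌝∊ω₁ k)
      (isCountable⇒countable ccc ≐-refl h)))) ,
    All∈-intro λ q≤p _ α∈ω₁ → Ex-intro (check-elim {x = ω₁} α∈ω₁ >>= λ r≤q (z , z∊ω₁ , α≐z) →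
      Ex-elim (isCountable-check (proj₂ (∊ω₁⁻ z∊ω₁)) α≐z))

-- Forcing with a tree

module TreeForcing (em : ∀ {ℓ} → ExcludedMiddle ℓ) (ext : ∀ {a b} → Extensionality a b) where
  open Choice em ext
  open Uncountable em ext
  open Clubs em ext

  -- The common interface of a Suslin tree and of the interval tree of a Suslin line. Uncountability
  -- stands in for height ω₁.
  record ThinUncountable (𝕋 : Tree) : Set₁ where
    open Tree 𝕋
    field
      chains      : ∀ S → IsChain S → CountablyMany _≈ᵗ_ S
      antichains  : ∀ S → IsAntichain S → CountablyMany _≈ᵗ_ S
      uncountable : ¬ CountablyMany {A = Carrier} _≈ᵗ_ (λ _ → ⊤)
      c           : Carrier → K
      c-injective : ∀ {s t} → c s ≡ c t → s ≈ᵗ t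

  module _ (𝕋 : Tree) (thin : ThinUncountable 𝕋) where
    open Tree 𝕋 using (Carrier; _<_; _≈ᵗ_; IsChain; predecessorsLinear; wellFounded; irrefl)
      renaming (order to order′)
    open StrictPartialOrder order′ using (isStrictPartialOrder; isEquivalence; <-respʳ-≈)
      renaming (trans to <-trans)
    open IsEquivalence isEquivalence using ()
      renaming (refl to ≈-reflᵗ; sym to ≈-symᵗ; trans to ≈-transᵗ)
    open ThinUncountable thin
    open ToNonStrict _≈ᵗ_ _<_ using () renaming (_≤_ to _≤ᵗ_; isPartialOrder to ≤-isPartialOrder)
    open IsPartialOrder (≤-isPartialOrder isStrictPartialOrder) using ()
      renaming (refl to ≤ᵗ-refl; trans to ≤ᵗ-trans; antisym to ≤ᵗ-antisym)

    comparable : ∀ {x y z} → x ≤ᵗ z → y ≤ᵗ z → x < y ⊎ x ≈ᵗ y ⊎ y < x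
    comparable (inj₁ x<z) (inj₁ y<z) = predecessorsLinear x<z y<z
    comparable (inj₁ x<z) (inj₂ y≈z) = inj₁ (<-respʳ-≈ (≈-symᵗ y≈z) x<z)
    comparable (inj₂ x≈z) (inj₁ y<z) = inj₂ (inj₂ (<-respʳ-≈ (≈-symᵗ x≈z) y<z))
    comparable (inj₂ x≈z) (inj₂ y≈z) = inj₂ (inj₁ (≈-transᵗ x≈z (≈-symᵗ y≈z)))

    Big : Carrier → Set
    Big s = ¬ CountablyMany _≈ᵗ_ (s ≤ᵗ_)

    -- The minimal nodes with countable cone form an antichain, so all nodes with
    -- countable cone above U are covered by countably many countable cones.
    big-uncountable : (U : Pred Carrier 0ℓ) → ¬ CountablyMany _≈ᵗ_ U →
                      ¬ CountablyMany _≈ᵗ_ (λ t → U t × Big t)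
    big-uncountable U ¬cU cB = ¬cU (countablyMany-∪ {Q = Part}
      (λ {x} u → part u em) λ { zero → cB ; (suc _) → small-countable })
      where
      Small Minimal : Carrier → Set
      Small t = U t × ¬ Big t
      Minimal t = Small t × ∀ s → s < t → ¬ Small s

      Part : ℕ → Carrier → Set
      Part zero    t = U t × Big t
      Part (suc _) t = Small t

      part : ∀ {t} → U t → Dec (Big t) → ∃[ n ] Part n t
      part u (yes b) = 0 , u , b
      part u (no ¬b) = 1 , u , ¬b

      minimal-countable : CountablyMany _≈ᵗ_ Minimal
      minimal-countable = antichains Minimal λ (x , _) (_ , my) x<y → my _ x<y x

      above-minimal : ∀ {t} → Acc _<_ t → Small t → ∃[ m ] Minimal m × m ≤ᵗ t
      above-minimal {t} (acc rs) b with em {P = ∃[ s ] s < t × Small s}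
      ... | yes (s , s<t , bs) = let m , mm , m≤s = above-minimal (rs s<t) bs in
                                 m , mm , ≤ᵗ-trans m≤s (inj₁ s<t)
      ... | no ¬∃              = t , (b , λ s s<t bs → ¬∃ (s , s<t , bs)) , ≤ᵗ-refl

      small-countable : CountablyMany _≈ᵗ_ Small
      small-countable = countablyMany-⋃ {M = Minimal} {R = _≤ᵗ_} minimal-countable
        (λ b≈b′ b≤x → ≤ᵗ-trans (inj₂ (≈-symᵗ b≈b′)) b≤x)
        (λ ((_ , ¬big) , _) → dne ¬big)
        (λ b → above-minimal (wellFounded _) b)

    infix 4 _⊑_

    record _⊑_ (p q : Σ Carrier Big) : Set where
      constructor ⟨_⟩
      field extends : proj₁ q ≤ᵗ proj₁ p
    open _⊑_ public

    P : Poset 0ℓ 0ℓ 0ℓ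
    P = record
      { Carrier        = Σ Carrier Big
      ; _≈_            = λ p q → proj₁ p ≈ᵗ proj₁ q
      ; _≤_            = _⊑_
      ; isPartialOrder = record
        { isPreorder = record
          { isEquivalence = On.isEquivalence proj₁ isEquivalence
          ; reflexive     = λ e → ⟨ inj₂ (≈-symᵗ e) ⟩
          ; trans         = λ p q → ⟨ ≤ᵗ-trans (extends q) (extends p) ⟩
          }
        ; antisym    = λ p q → ≤ᵗ-antisym (extends q) (extends p)
        }
      }

    open Names P
    open Truth em ext P
    open Semantics em ext P
    open ω₁-Preservation em ext P
    open Interpreted unbounded

    -- The larger of two comparable nodes is itself a common extension, so pairwise incompatible
    -- conditions form an antichain of the tree.
    ccc : CountableChainCondition
    ccc Q q compatible = countablyMany-preimage (proj₁ ∘ q) (λ {i} Qi → i , Qi , refl)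
      (λ Qi Qj e → compatible Qi Qj ≤-refl ⟨ inj₂ (≈-symᵗ e) ⟩)
      (antichains (λ t → ∃[ i ] Q i × proj₁ (q i) ≡ t) antichain)
      where
      antichain : ∀ {x y} →
                  (∃[ i ] Q i × proj₁ (q i) ≡ x) → (∃[ i ] Q i × proj₁ (q i) ≡ y) → ¬ x < y
      antichain (i , Qi , refl) (j , Qj , refl) x<y with compatible Qi Qj ⟨ inj₁ x<y ⟩ ≤-refl
      ... | refl = irrefl ≈-reflᵗ x<y

    abstract
      -- The part of the branch `d` known from the node with code k: the labels of the nodes up to
      -- it, and ω₁, which always belongs to `d`. If k codes no node, only ω₁ is left.
      E : K → V
      E k = sup ((Σ[ t ∈ Carrier ] ∃[ s ] c s ≡ k × t ≤ᵗ s) ⊎ ⊤)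
                [ (λ (t , _) → ⌜ c t ⌝) , (λ _ → ω₁) ]′

      E-code : ∀ {s t} → t ≤ᵗ s → ⌜ c t ⌝ ∊ E (c s)
      E-code t≤s = ∊-intro (inj₁ (_ , _ , refl , t≤s)) ≅-refl

      E-ω₁ : ∀ {k} → ω₁ ∊ E k
      E-ω₁ = ∊-intro (inj₂ tt) ≅-refl

      E⁻ : ∀ {x s} → x ∊ E (c s) → (∃[ t ] t ≤ᵗ s × x ≅ ⌜ c t ⌝) ⊎ x ≅ ω₁
      E⁻ (∈⇒∊ (inj₁ (t , s′ , e , t≤s′) , p)) = inj₁ (t , ≤ᵗ-trans t≤s′ (inj₂ (c-injective e)) , ≈⇒≅ p)
      E⁻ (∈⇒∊ (inj₂ _ , p)) = inj₂ (≈⇒≅ p)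

    label : Cond → V
    label p = ⌜ c (proj₁ p) ⌝

    -- The generic branch, with ω₁ added so that the supremum is attained.
    abstract
      d : Name
      d = name (Cond ⊎ Cond) [ check ∘ label , (λ _ → check ω₁) ]′ [ id , id ]′

      d-elim : ∀ {p σ} → p ⊩ σ ∈ d →
               Densely (λ r → (∃[ q ] r ≤ q × (r ⊩ σ ≐ check (label q))) ⊎ (r ⊩ σ ≐ check ω₁)) p
      d-elim h = map-densely
        (λ { _ (inj₁ q , r≤q , e) → inj₁ (q , r≤q , e) ; _ (inj₂ _ , _ , e) → inj₂ e })
                             (∈-elim h)

      d-label : ∀ {p q} → p ≤ q → p ⊩ check (label q) ∈ d
      d-label {q = q} p≤q = sub-∈ d (inj₁ q) p≤q

      d-ω₁ : ∀ {p} → p ⊩ check ω₁ ∈ d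
      d-ω₁ {p} = sub-∈ d (inj₂ p) ≤-refl

    d⊆succ-ω₁ : ∀ {p σ} → p ⊩ σ ∈ d → p ⊩ σ ∈ check (succ ω₁)
    d⊆succ-ω₁ h = ∈-densely (map-densely
      (λ { _ (inj₁ (q , _ , e)) → ∈-respˡ (≐-sym e) (check-∊ (succ⁺ (⌜⌝∊ω₁ (c (proj₁ q)))))
         ; _ (inj₂ e)           → ∈-respˡ (≐-sym e) (check-∊ (∊-succ ω₁)) }) (d-elim h))

    -- Countable approximation and the failure of guessing

    module _ (N : V) (N-closed : Closed E N) where

      ω₁∊N : ω₁ ∊ N
      ω₁∊N = closed-transitive N-closed (∊-succ ω₁) (succ-ω₁∊ N-closed)

      N-transitive : ∀ {p} → Transitiveᶠ (check N) p
      N-transitive = check-transitive (closed-transitive N-closed)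

      abstract
        N∩On sup[N∩On] : V
        N∩On = sup (Σ[ i ∈ Index N ] T ⌊ IsOrdinal (element N i) ⌋) (λ (i , _) → element N i)
        sup[N∩On] = ⋃ N∩On

        sup[N∩On]⁺ : ∀ {x z} → x ∊ N → IsOrdinal x → z ∊ x → z ∊ sup[N∩On]
        sup[N∩On]⁺ x∊N o z∊x = ⋃⁺ z∊x
          (∊-intro {x = N∩On} (index x∊N , ⌊⌋⁺ (IsOrdinal-resp (≅-index x∊N) o)) (≅-index x∊N))

        sup[N∩On]⁻ : ∀ {z} → z ∊ sup[N∩On] → ∃[ x ] x ∊ N × IsOrdinal x × z ∊ x
        sup[N∩On]⁻ (∈⇒∊ (((i , o) , j) , p)) =
          element N i , ∊-element N i , ⌊⌋⁻ o , ∈⇒∊ (j , p)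

        sup[N∩On]-ordinal : IsOrdinal sup[N∩On]
        sup[N∩On]-ordinal = IsOrdinal-⋃ {N∩On} (λ (_ , o) → ⌊⌋⁻ o)

      ω₁∊sup[N∩On] : ω₁ ∊ sup[N∩On]
      ω₁∊sup[N∩On] = sup[N∩On]⁺ (succ-ω₁∊ N-closed) (IsOrdinal-succ ω₁-ordinal) (∊-succ ω₁)

      d⊆N∩On : ∀ {p} → (all[ α ε d ] (α ε check N ∧ isOrdinal α)) p
      d⊆N∩On = All∈-intro λ _ _ α∈d →
        ε⁺ (N-transitive ≤-refl (check-∊ (succ-ω₁∊ N-closed)) (d⊆succ-ω₁ α∈d)) ,
        isOrdinal⁺ (Ordinalᶠ-∈ (check-ordinal (IsOrdinal-succ ω₁-ordinal)) (d⊆succ-ω₁ α∈d))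

      sup-d : ∀ {p} → isSup (check ω₁) (λ α → α ε d) p
      sup-d = (isOrdinal⁺ (check-ordinal ω₁-ordinal) , (λ α q q≤p α∈d →
          ∨-intro {α ε check ω₁} {α ≐ check ω₁} (map-densely (λ _ (x , x∊ , α≐x) →
            [ (λ x∊ω₁ → inj₁ (ε⁺ (∈-respˡ (≐-sym α≐x) (check-∊ x∊ω₁))))
            , (λ x≅ω₁ → inj₂ (≐⁺ (≐-trans α≐x (check-≅ x≅ω₁)))) ]′ (succ⁻ x∊))
            (check-elim {x = succ ω₁} (d⊆succ-ω₁ (ε⁻ α∈d)))))) ,
        λ u q q≤p (_ , upper) → upper (check ω₁) q ≤-refl (ε⁺ d-ω₁)

      -- The ordinals in the check name of N are ground model ordinals, and none of them can contain
      -- the union of all of them. A bound u below the union would lie in some ordinal γ of N, but u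
      -- has to bound γ.
      sup-N∩On : ∀ {p} → isSup (check sup[N∩On]) (λ α → α ε check N ∧ isOrdinal α) p
      sup-N∩On = (isOrdinal⁺ (check-ordinal sup[N∩On]-ordinal) , (λ α q q≤p (α∈N , o) →
          ∨-intro {α ε check sup[N∩On]} {α ≐ check sup[N∩On]} (map-densely (λ r≤q (x , x∊N , α≐x) →
            let ox = check-ordinal⁻ (Ordinalᶠ-resp α≐x (Ordinalᶠ-mono r≤q (isOrdinal⁻ tt o))) in
            [ (λ τ∊x → ⊥-elim (∊-irrefl ≅-refl (sup[N∩On]⁺ x∊N ox τ∊x)))
            , [ (λ τ≅x → inj₂ (≐⁺ (≐-trans α≐x (check-≅ (≅-sym τ≅x)))))
              , (λ x∊τ → inj₁ (ε⁺ (∈-respˡ (≐-sym α≐x) (check-∊ x∊τ)))) ]′ ]′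
            (compare sup[N∩On]-ordinal ox)) (check-elim (ε⁻ α∈N))))) ,
        λ u q q≤p (o , upper) → ∨-intro {check sup[N∩On] ε u} {check sup[N∩On] ≐ u} (map-densely
          (λ { _ (inj₂ (inj₂ τ∈u)) → inj₁ (ε⁺ τ∈u)
             ; _ (inj₂ (inj₁ u≐τ)) → inj₂ (≐⁺ (≐-sym u≐τ))
             ; {r} r≤q (inj₁ u∈τ) → ⊥-elim (not-below upper r≤q u∈τ) })
          (compareᶠ sup[N∩On]-ordinal (isOrdinal⁻ tt o)))
        where
        not-below : ∀ {u q r} → (all[ α ] (α ε check N ∧ isOrdinal α ⇒ α ε u ∨ α ≐ u)) q →
                    r ≤ q → ¬ (r ⊩ u ∈ check sup[N∩On])
        not-below {u} {q} {r} upper r≤q u∈τ =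
          let s , s≤r , β , β∊τ , u≐β = check-elim u∈τ r ≤-refl
              γ , γ∊N , oγ , β∊γ = sup[N∩On]⁻ β∊τ
          in contradict β∊γ u≐β (upper (check γ) s (≤-trans s≤r r≤q)
               (ε⁺ (check-∊ γ∊N) , isOrdinal⁺ (check-ordinal oγ)))
          where
          contradict : ∀ {β γ s} → β ∊ γ → s ⊩ u ≐ check β → ¬ (check γ ε u ∨ check γ ≐ u) s
          contradict {β} {γ} {s} β∊γ u≐β h with ∨-elim {check γ ε u} {check γ ≐ u} h s ≤-refl
          ... | t , t≤s , inj₁ γ∈u = ∊-asym β∊γ (check-∊⁻ (∈-respʳ (≐-mono t≤s u≐β) (ε⁻ γ∈u)))
          ... | t , t≤s , inj₂ γ≐u =
            ∊-irrefl (≅-sym (check-≅⁻ (≐-trans (≐⁻ γ≐u) (≐-mono t≤s u≐β)))) β∊γ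

      module Boundedᶠ = Interpreted (boundedBy N (closed-transitive N-closed) ω₁∊N)

      -- A condition lying below none of the countably many nodes with label in a
      -- decides the intersection of a with the generic branch.
      deciding : ∀ {a} → CountablyMany _≡_ (λ k → ⌜ k ⌝ ∊ a) → ∀ p →
                 ∃[ q ] q ≤ p × (∀ t → ⌜ c t ⌝ ∊ a → ¬ proj₁ q < t)
      deciding {a} ca (s , s-big)
        with em {P = ∃[ y ] (s ≤ᵗ y × Big y) × (∀ t → ⌜ c t ⌝ ∊ a → ¬ y < t)}
      ... | yes (y , (s≤y , y-big) , h) = (y , y-big) , ⟨ s≤y ⟩ , h
      -- Otherwise each big node above s lies strictly below a node labelled in a. There are
      -- countably many of these, and the predecessors of each form a chain, so only countably many
      -- big nodes would be above s.
      ... | no ¬∃ = ⊥-elim (big-uncountable (s ≤ᵗ_) s-big (countablyMany-⋃ {M = λ t → ⌜ c t ⌝ ∊ a}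
              {R = λ t y → y < t}
              (countablyMany-preimage c id (λ _ _ → c-injective) ca)
              (λ t≈t′ y<t → <-respʳ-≈ t≈t′ y<t)
              (λ {t} _ → chains (_< t) predecessorsLinear)
              (λ {y} h → dne λ ¬∃t → ¬∃ (y , h , λ t t∊a y<t → ¬∃t (t , t∊a , y<t)))))

      -- The witness is a name for an injection into what N takes to be ω. The chain condition
      -- argument, read with quantifiers over names of elements of N, applies to it directly.
      truly-countable : ∀ {a x p q} → q ≤ p → q ⊩ a ≐ check x →
                        Formulas.isCountable (forcing ↾ check N) a p →
                        CountablyMany _≡_ (λ k → ⌜ k ⌝ ∊ x)
      truly-countable {a} q≤p a≐x h =
        Boundedᶠ.isCountable⇒countable ccc a≐x (Boundedᶠ.isCountable-mono {a} q≤p h)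

      approximated : ∀ {p} → Guessing.isCountablyApproximatedBy forcing d (check N) p
      approximated a q q≤p a∈N r r≤q cnt =
        Ex∈-intro {check N} {λ σ → isIntersection σ d a} λ s s≤r →
        let t , t≤s , x , x∊N , a≐x = check-elim (ε⁻ {τ = check N} a∈N) s (≤-trans s≤r r≤q)
            u , u≤t , h = approximation x∊N a≐x (truly-countable (≤-trans t≤s s≤r) a≐x cnt)
        in u , ≤-trans u≤t t≤s , h
        where
        intersection : ∀ {a} x u → u ⊩ a ≐ check x → (∀ t → ⌜ c t ⌝ ∊ x → ¬ proj₁ u < t) →
                       isIntersection (check (x ∩ E (c (proj₁ u)))) d a u
        intersection {a} x u@(y , y-big) a≐x above z =
          (λ q q≤u z∈ → let z∈d , z∈a = forward q≤u (ε⁻ z∈) in ε⁺ z∈d , ε⁺ z∈a) ,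
          (λ q q≤u (z∈d , z∈a) → ε⁺ (backward q≤u (ε⁻ z∈d) (ε⁻ z∈a)))
          where
          in-x : ∀ {z w r} → r ≤ u → r ⊩ z ∈ a → r ⊩ z ≐ check w → w ∊ x
          in-x r≤u z∈a z≐w = check-∊⁻ (∈-respʳ (≐-mono r≤u a≐x) (∈-respˡ z≐w z∈a))

          in-d : ∀ {w r} → r ≤ u → w ∊ E (c y) → r ⊩ check w ∈ d
          in-d r≤u w∊E with E⁻ w∊E
          ... | inj₂ w≅ω₁ = ∈-respˡ (check-≅ (≅-sym w≅ω₁)) d-ω₁
          -- A predecessor t of y is again a condition, since its cone contains the cone of y.
          ... | inj₁ (t , t≤y , w≅t) = ∈-respˡ (check-≅ (≅-sym w≅t)) (d-label {q = t ,
                  λ cnt → y-big (countablyMany-⊆ (≤ᵗ-trans t≤y) cnt)} ⟨ ≤ᵗ-trans t≤y (extends r≤u) ⟩)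

          -- Both p and y precede r and so are comparable; y < p is excluded because p is labelled
          -- in x.
          below : ∀ {p r} → label p ∊ x → r ≤ u → r ≤ p → proj₁ p ≤ᵗ y
          below p∊x r≤u r≤p with comparable (extends r≤p) (extends r≤u)
          ... | inj₁ p<y        = inj₁ p<y
          ... | inj₂ (inj₁ p≈y) = inj₂ p≈y
          ... | inj₂ (inj₂ y<p) = ⊥-elim (above _ p∊x y<p)

          forward : ∀ {z q} → q ≤ u → q ⊩ z ∈ check (x ∩ E (c y)) → (q ⊩ z ∈ d) × (q ⊩ z ∈ a)
          forward {z} {q} q≤u h =
            ∈-densely (map-densely (λ r≤q (w , w∊ , z≐w) →
              ∈-respˡ (≐-sym z≐w) (in-d (≤-trans r≤q q≤u) (proj₂ (∩⁻ w∊)))) (check-elim h)) ,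
            ∈-densely (map-densely (λ r≤q (w , w∊ , z≐w) →
              ∈-respˡ (≐-sym z≐w) (∈-respʳ (≐-sym (≐-mono (≤-trans r≤q q≤u) a≐x))
                                           (check-∊ (proj₁ (∩⁻ w∊))))) (check-elim h))

          backward : ∀ {z q} → q ≤ u → q ⊩ z ∈ d → q ⊩ z ∈ a → q ⊩ z ∈ check (x ∩ E (c y))
          backward {z} {q} q≤u z∈d z∈a = ∈-densely (map-densely here (d-elim z∈d))
            where
            here : ∀ {r} → r ≤ q → (∃[ p ] r ≤ p × (r ⊩ z ≐ check (label p))) ⊎ (r ⊩ z ≐ check ω₁) →
                   r ⊩ z ∈ check (x ∩ E (c y))
            here r≤q (inj₁ (p , r≤p , z≐p)) =
              let r≤u = ≤-trans r≤q q≤u ; p∊x = in-x {w = label p} r≤u (∈-mono r≤q z∈a) z≐p in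
              ∈-respˡ (≐-sym z≐p) (check-∊ (∩⁺ p∊x (E-code (below {p} p∊x r≤u r≤p))))
            here r≤q (inj₂ z≐ω₁) = ∈-respˡ (≐-sym z≐ω₁)
              (check-∊ {z = ω₁} (∩⁺ {z = ω₁}
                (in-x {w = ω₁} (≤-trans r≤q q≤u) (∈-mono r≤q z∈a) z≐ω₁) E-ω₁))

        approximation : ∀ {a x t} → x ∊ N → t ⊩ a ≐ check x → CountablyMany _≡_ (λ k → ⌜ k ⌝ ∊ x) →
          ∃[ u ] u ≤ t × Σ[ σ ∈ Name ] ⊤ × (u ⊩ σ ∈ check N) × isIntersection σ d a u
        approximation {x = x} {t} x∊N a≐x countable =
          let u , u≤t , above = deciding {x} countable t
          in u , u≤t , check (x ∩ E (c (proj₁ u))) , tt ,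
             check-∊ (∩-closed N-closed (c (proj₁ u)) x∊N) ,
             intersection x u (≐-mono u≤t a≐x) above

      not-guessed : ∀ {p} → ¬ Guessing.isGuessedBy forcing d (check N) p
      not-guessed {p} guessed =
        let q , _ , e , _ , e∈N , int =
              Ex∈-elim {check N} {λ e → isIntersection d e (check N)} guessed p ≤-refl
            r , r≤q , x , x∊N , e≐x = check-elim e∈N q ≤-refl
        in contradict e≐x (λ z → let f , g = int z in
             (λ s s≤r → f s (≤-trans s≤r r≤q)) , (λ s s≤r → g s (≤-trans s≤r r≤q)))
        where
        contradict : ∀ {e x r} → r ⊩ e ≐ check x → isIntersection d e (check N) r → ⊥
        contradict {e} {x} {r@(s , s-big)} e≐x int =
          big-uncountable (s ≤ᵗ_) s-big (chains (λ t → s ≤ᵗ t × Big t) chain)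
          where
          -- The condition q forces its own label into `d`, hence into the guess, which is the
          -- ground model set x. Membership in x does not depend on the condition, so r already
          -- forces the label into `d`.
          decided : ∀ {q} → q ≤ r → r ⊩ check (label q) ∈ d
          decided {q} q≤r =
            let ∈e , _ = proj₁ (int (check (label q))) q q≤r (ε⁺ (d-label {q} ≤-refl))
                ∊x = check-∊⁻ (∈-respʳ (≐-mono q≤r e≐x) (ε⁻ ∈e))
            in ε⁻ (proj₂ (int (check (label q))) r ≤-refl
                 ( ε⁺ (∈-respʳ (≐-sym e≐x) (check-∊ ∊x))
                 , ε⁺ (check-∊ (closed-transitive N-closed (⌜⌝∊ω₁ (c (proj₁ q))) ω₁∊N)) ))

          -- Since r forces the label of y into `d`, below z there is a condition t extending y as
          -- well; y and z are then comparable as predecessors of t.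
          chain : IsChain (λ t → s ≤ᵗ t × Big t)
          chain {y} {z} (s≤y , y-big) (s≤z , z-big) =
            let t , t≤z , h = d-elim (decided {y , y-big} ⟨ s≤y ⟩) (z , z-big) ⟨ s≤z ⟩ in meet t≤z h
            where
            meet : ∀ {t} → t ≤ (z , z-big) →
                   (∃[ q ] t ≤ q × (t ⊩ check ⌜ c y ⌝ ≐ check (label q))) ⊎
                   (t ⊩ check ⌜ c y ⌝ ≐ check ω₁) →
                   y < z ⊎ y ≈ᵗ z ⊎ z < y
            meet _ (inj₂ e) = ⊥-elim (∊-irrefl (check-≅⁻ {x = ⌜ c y ⌝} {ω₁} e) (⌜⌝∊ω₁ (c y)))
            meet t≤z (inj₁ (q , t≤q , e)) = comparable (≤ᵗ-trans
              (inj₂ (c-injective (⌜⌝-injective (check-≅⁻ {x = ⌜ c y ⌝} {label q} e))))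
              (extends t≤q)) (extends t≤z)

      not-guessing : ¬ Forces-ω₁-Guessing N
      not-guessing guessing with em {P = Cond}
      -- Over an empty poset every forcing statement is vacuous; a condition exists because
      -- uncountably many nodes are big.
      ... | no ¬p = big-uncountable (λ _ → ⊤) uncountable (record
              { code = λ _ _ → 0 ; code-injective = λ {x} (_ , b) → ⊥-elim (¬p (x , b)) })
      ... | yes p = not-guessed (guessing p d p ≤-refl
              ( d⊆N∩On
              , Ex-intro (λ q _ → q , ≤-refl , check ω₁ , tt ,
                  Ex-intro λ r _ → r , ≤-refl , check sup[N∩On] , tt ,
                  sup-d , sup-N∩On , ε⁺ (check-∊ ω₁∊sup[N∩On]))
              , approximated ))

    IGMP-refuted : ¬ IGMP⟨ω₂⟩
    IGMP-refuted igmp =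
      let N , CN , _ , indestructible = igmp (closedSets E) (closedSets-club E) in
      not-guessing N (⌊⌋⁻ CN) (indestructible P (preserves-ω₁ ccc))

-- Suslin trees and Suslin lines

module SuslinTree (em : ∀ {ℓ} → ExcludedMiddle ℓ) (ext : ∀ {a b} → Extensionality a b)
                  (𝕋 : Tree) (suslin : Isω₁-Suslin 𝕋) where
  open Choice em ext
  open Uncountable em ext
  open TreeForcing em ext using (ThinUncountable)
  open Tree 𝕋 hiding (trans)
  open Isω₁-Suslin suslin

  ht-∊ : ∀ {s t} → s < t → ht s ∊ ht t
  ht-∊ s<t = collapse-∊⁺ (wellFounded _) (wellFounded _) s<t

  ht-cong : ∀ {s t} → s ≈ᵗ t → ht s ≅ ht t
  ht-cong s≈t = ≅-ext (⊆ s≈t) (⊆ (Eq.sym s≈t))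
    where
    ⊆ : ∀ {s t} → s ≈ᵗ t → ∀ {z} → z ∊ ht s → z ∊ ht t
    ⊆ s≈t z∊ = let b , b<s , q , z≅ = collapse-∊⁻ (wellFounded _) z∊ in
      ∊-respˡ (≅-sym z≅) (collapse-∊⁺ (wellFounded _) q (<-respʳ-≈ s≈t b<s))

  level : Carrier → K
  level t = point {ht t} (∊-respʳ (≈⇒≅ height≈ω₁) (∊-element height t))

  ≅-level : ∀ t → ht t ≅ ⌜ level t ⌝
  ≅-level t = ≅-point (∊-respʳ (≈⇒≅ height≈ω₁) (∊-element height t))

  level-antichain : ∀ k → IsAntichain (λ t → level t ≡ k)
  level-antichain k {x} {y} ex ey x<y = ∊-irrefl
    (≅-trans (≅-level x) (subst (λ l → ⌜ l ⌝ ≅ ht y) (trans ey (sym ex)) (≅-sym (≅-level y)))) (ht-∊ x<y)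

  level-countable : ∀ k → CountablyMany _≈ᵗ_ (λ t → level t ≡ k)
  level-countable k = countable⁻ (antichainsCountable _ (level-antichain k))

  -- Every countable ordinal is the height of some node, so a coding of the nodes would code ω₁.
  nodes-uncountable : ¬ CountablyMany {A = Carrier} _≈ᵗ_ (λ _ → ⊤)
  nodes-uncountable c = ω₁-uncountable record
    { code           = λ _ h → code c (node h) tt
    ; code-injective = λ p q e → ≅-trans (≅-index (in-height p))
        (≅-trans (ht-cong (code-injective c tt tt e)) (≅-sym (≅-index (in-height q))))
    }
    where
    in-height : ∀ {z} → z ∊ ω₁ → z ∊ height
    in-height = ∊-respʳ (≅-sym (≈⇒≅ height≈ω₁))
    node : ∀ {z} → z ∊ ω₁ → Carrier
    node h = index (in-height h)

  thin : ThinUncountable 𝕋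
  thin = record
    { chains      = λ S h → countable⁻ (chainsCountable S h)
    ; antichains  = λ S h → countable⁻ (antichainsCountable S h)
    ; uncountable = nodes-uncountable
    -- Levels are antichains, hence countable, so the level map has countable fibres.
    ; c           = embed level level-countable
    ; c-injective = embed-injective level level-countable
    }

-- The interval tree of a Suslin line

module SuslinLine (em : ∀ {ℓ} → ExcludedMiddle ℓ) (ext : ∀ {a b} → Extensionality a b)
                  (L : StrictTotalOrder 0ℓ 0ℓ 0ℓ) (suslin : IsSuslinLine L) where
  open Choice em ext
  open Uncountable em ext
  open TreeForcing em ext using (ThinUncountable)
  open StrictTotalOrder L renaming (_≈_ to _≈ˡ_; trans to <-trans; compare to <-cmp)

  private
    dense : DenseOrder L
    dense = proj₁ suslin

    ccc : CCC L
    ccc = proj₁ (proj₂ suslin)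

    nonseparable : ¬ Separable L
    nonseparable = proj₂ (proj₂ suslin)

  -- The endpoints, avoided by later intervals, make intervals nested or disjoint; the midpoint,
  -- also avoided, leaves one half of an interval free along a chain.
  record Interval : Set where
    field
      lo mid hi : Carrier
      lo<mid    : lo < mid
      mid<hi    : mid < hi
  open Interval

  Between : Carrier → Carrier → Carrier → Set
  Between a b x = a < x × x < b

  IsMark : Interval → Carrier → Set
  IsMark I x = x ≈ˡ lo I ⊎ x ≈ˡ mid I ⊎ x ≈ˡ hi I

  _Avoids_ : Interval → Pred Carrier 0ℓ → Set
  I Avoids D = ∀ {x} → D x → ¬ Between (lo I) (hi I) x

  -- If every interval met D, then D would witness separability; density supplies the midpoint.
  avoiding : (D : Pred Carrier 0ℓ) → CountablyMany _≈ˡ_ D → ∃[ I ] I Avoids D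
  avoiding D cD with em {P = ∃[ I ] I Avoids D}
  ... | yes h = h
  ... | no ¬∃ = ⊥-elim (nonseparable (D , countable⁺ cD , λ {a} {b} a<b → dne λ none →
          let m , a<m , m<b = dense a<b in
          ¬∃ (record { lo<mid = a<m ; mid<hi = m<b } , λ Dx (a<x , x<b) → none (_ , Dx , a<x , x<b))))

  marks-countable : ∀ I → CountablyMany _≈ˡ_ (IsMark I)
  marks-countable I = record { code = λ _ → number-of ; code-injective = injective }
    where
    number-of : ∀ {x} → IsMark I x → ℕ
    number-of (inj₁ _)        = 0
    number-of (inj₂ (inj₁ _)) = 1
    number-of (inj₂ (inj₂ _)) = 2
    injective : ∀ {x y} (p : IsMark I x) (q : IsMark I y) → number-of p ≡ number-of q → x ≈ˡ y
    injective (inj₁ p)        (inj₁ q)        _ = Eq.trans p (Eq.sym q)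
    injective (inj₁ _)        (inj₂ (inj₁ _)) ()
    injective (inj₁ _)        (inj₂ (inj₂ _)) ()
    injective (inj₂ (inj₁ p)) (inj₂ (inj₁ q)) _ = Eq.trans p (Eq.sym q)
    injective (inj₂ (inj₂ p)) (inj₂ (inj₂ q)) _ = Eq.trans p (Eq.sym q)

  private
    -- Proof-irrelevant, so that a recursive call depends on its argument only.
    _≺_ : Rel K 0ℓ
    k ≺ l = T ⌊ k <ₖ l ⌋

    ≺-wf : WellFounded _≺_
    ≺-wf = WF.Subrelation.wellFounded ⌊⌋⁻ <ₖ-wellFounded

    Earlier : ∀ k → (∀ l → l ≺ k → Interval) → Pred Carrier 0ℓ
    Earlier k IH x = Σ[ l ∈ K ] Σ[ l≺k ∈ l ≺ k ] IsMark (IH l l≺k) x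

    earlier-countable : ∀ k IH → CountablyMany _≈ˡ_ (Earlier k IH)
    earlier-countable k IH = countablyMany-⋃
      {M = _≺ k} {R = λ l x → Σ[ l≺k ∈ l ≺ k ] IsMark (IH l l≺k) x}
      (countablyMany-⊆ (λ l≺k → succ⁺ (⌊⌋⁻ l≺k)) (≤ₖ-countable k))
      (λ { refl r → r })
      (λ {l} l≺k → countablyMany-⊆
        (λ {x} (p , mark) → subst (λ q → IsMark (IH l q) x) (T-irrelevant p l≺k) mark)
        (marks-countable (IH l l≺k)))
      (λ (l , l≺k , mark) → l , l≺k , l≺k , mark)

    abstract
      step : ∀ k → (∀ l → l ≺ k → Interval) → Interval
      step k IH = proj₁ (avoiding (Earlier k IH) (earlier-countable k IH))

      step-avoids : ∀ k IH → step k IH Avoids Earlier k IH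
      step-avoids k IH = proj₂ (avoiding (Earlier k IH) (earlier-countable k IH))

    module Fix = WF.FixPoint ≺-wf (λ _ → Interval) (λ k IH → step k (λ l → IH {l}))
      (λ k h → cong (step k) (ext λ l → ext λ l≺k → h l≺k))

  abstract
    interval : K → Interval
    interval = WF.All.wfRec ≺-wf 0ℓ (λ _ → Interval) (λ k IH → step k (λ l → IH {l}))

    interval-step : ∀ k → interval k ≡ step k (λ l _ → interval l)
    interval-step k = Fix.unfold-wfRec {k}

  interval-avoids : ∀ {k l x} → k <ₖ l → IsMark (interval k) x →
                    ¬ Between (lo (interval l)) (hi (interval l)) x
  interval-avoids {k} {l} {x} k<l mark =
    subst (λ I → ¬ Between (lo I) (hi I) x) (sym (interval-step l))
    (step-avoids l (λ m _ → interval m) (k , ⌊⌋⁺ k<l , mark))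

  infix 4 _∈ᴵ_

  _∈ᴵ_ : Carrier → K → Set
  x ∈ᴵ k = Between (lo (interval k)) (hi (interval k)) x

  midpoint : K → Carrier
  midpoint k = mid (interval k)

  midpoint-∈ : ∀ k → midpoint k ∈ᴵ k
  midpoint-∈ k = lo<mid (interval k) , mid<hi (interval k)

  midpoint-∉ : ∀ {k l} → k <ₖ l → ¬ midpoint k ∈ᴵ l
  midpoint-∉ k<l = interval-avoids k<l (inj₂ (inj₁ Eq.refl))

  -- The later interval contains no endpoint of the earlier one, so once they share a point it
  -- cannot stick out on either side.
  nested : ∀ {k l z} → k <ₖ l → z ∈ᴵ k → z ∈ᴵ l → ∀ {x} → x ∈ᴵ l → x ∈ᴵ k
  nested {k} {l} {z} k<l (lo<z , z<hi) (lo′<z , z<hi′) {x} (lo′<x , x<hi′) = above , below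
    where
    lo∉ = interval-avoids k<l (inj₁ Eq.refl)
    hi∉ = interval-avoids k<l (inj₂ (inj₂ Eq.refl))
    above : lo (interval k) < x
    above with <-cmp (lo (interval k)) x
    ... | tri< lo<x _ _ = lo<x
    ... | tri≈ _ lo≈x _ = ⊥-elim (lo∉ (<-respʳ-≈ (Eq.sym lo≈x) lo′<x , <-trans lo<z z<hi′))
    ... | tri> _ _ x<lo = ⊥-elim (lo∉ (<-trans lo′<x x<lo , <-trans lo<z z<hi′))
    below : x < hi (interval k)
    below with <-cmp x (hi (interval k))
    ... | tri< x<hi _ _ = x<hi
    ... | tri≈ _ x≈hi _ = ⊥-elim (hi∉ (<-trans lo′<z z<hi , <-respˡ-≈ x≈hi x<hi′))
    ... | tri> _ _ hi<x = ⊥-elim (hi∉ (<-trans lo′<z z<hi , <-trans hi<x x<hi′))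

  infix 4 _⊏_

  -- Reverse inclusion; the order of construction is included so that well-foundedness is inherited
  -- from `K`.
  _⊏_ : Rel K 0ℓ
  k ⊏ l = k <ₖ l × ∀ {x} → x ∈ᴵ l → x ∈ᴵ k

  ⊏-compare : ∀ {k l z} → z ∈ᴵ k → z ∈ᴵ l → k ⊏ l ⊎ k ≡ l ⊎ l ⊏ k
  ⊏-compare {k} {l} z∈k z∈l with <ₖ-compare k l
  ... | inj₁ k<l        = inj₁ (k<l , nested k<l z∈k z∈l)
  ... | inj₂ (inj₁ k≡l) = inj₂ (inj₁ k≡l)
  ... | inj₂ (inj₂ l<k) = inj₂ (inj₂ (l<k , nested l<k z∈l z∈k))

  𝕋 : Tree
  𝕋 = record
    { order = record
      { Carrier = K
      ; _≈_     = _≡_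
      ; _<_     = _⊏_
      ; isStrictPartialOrder = record
        { isEquivalence = Setoid.isEquivalence (setoid K)
        ; irrefl        = λ { refl (k<k , _) → ∊-irrefl ≅-refl k<k }
        ; trans         = λ (p , f) (q , g) → <ₖ-trans p q , λ x∈ → f (g x∈)
        ; <-resp-≈      = (λ { refl h → h }) , (λ { refl h → h })
        }
      }
    ; wellFounded        = WF.Subrelation.wellFounded proj₁ <ₖ-wellFounded
    -- The midpoint of t is a common point of the two intervals containing that of t.
    ; predecessorsLinear = λ {t} (_ , f) (_ , g) → ⊏-compare (f (midpoint-∈ t)) (g (midpoint-∈ t))
    }

  -- `CCC` counts intervals as pairs of endpoints, not indices. Density puts a point into each
  -- interval, so two indices with equal endpoints share a point and coincide.
  disjoint-countable : (S : Pred K 0ℓ) (a b : K → Carrier) → (∀ k → a k < b k) →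
    (∀ {k l x} → S k → S l → Between (a k) (b k) x → Between (a l) (b l) x → k ≡ l) →
    CountablyMany _≡_ S
  disjoint-countable S a b a<b disjoint = countablyMany-preimage (λ k → a k , b k)
    (λ {k} Sk → k , Sk , refl , refl)
    (λ {k} {l} Sk Sl (a≈ , b≈) → let x , a<x , x<b = dense (a<b k) in
      disjoint Sk Sl (a<x , x<b) (<-respˡ-≈ a≈ a<x , <-respʳ-≈ b≈ x<b))
    (countable⁻ {S = ×-setoid Eq.setoid Eq.setoid} (ccc family
      (λ { (k , _ , refl , refl) → a<b k }) overlapping))
    where
    family : Pred (Carrier × Carrier) 0ℓ
    family (u , v) = Σ[ k ∈ K ] S k × u ≡ a k × v ≡ b k

    overlapping : ∀ {u v u′ v′ x} → family (u , v) → family (u′ , v′) →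
              u < x → x < v → u′ < x → x < v′ → u ≈ˡ u′ × v ≈ˡ v′
    overlapping (k , Sk , refl , refl) (l , Sl , refl , refl) p q p′ q′
      with disjoint Sk Sl (p , q) (p′ , q′)
    ... | refl = Eq.refl , Eq.refl

  antichain-countable : ∀ S → Tree.IsAntichain 𝕋 S → CountablyMany _≡_ S
  antichain-countable S antichain = disjoint-countable S (lo ∘ interval) (hi ∘ interval)
    (λ k → <-trans (lo<mid (interval k)) (mid<hi (interval k)))
    (λ {k} {l} Sk Sl x∈k x∈l → [ (λ k⊏l → ⊥-elim (antichain Sk Sl k⊏l))
      , [ id , (λ l⊏k → ⊥-elim (antichain Sl Sk l⊏k)) ]′ ]′ (⊏-compare x∈k x∈l))

  -- The intervals above k in a chain all lie on the same side of the midpoint of k,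
  -- so the other halves of the intervals of the chain are pairwise disjoint.
  module Chain (S : Pred K 0ℓ) (chain : Tree.IsChain 𝕋 S) where

    Left : K → Set
    Left k = Σ[ l ∈ K ] S l × k <ₖ l × ∃[ x ] x ∈ᴵ l × x < midpoint k

    start end : ∀ {k} → Dec (Left k) → Carrier
    start {k} (yes _) = midpoint k
    start {k} (no _)  = lo (interval k)
    end   {k} (yes _) = hi (interval k)
    end   {k} (no _)  = midpoint k

    start<end : ∀ {k} (d : Dec (Left k)) → start d < end d
    start<end {k} (yes _) = mid<hi (interval k)
    start<end {k} (no _)  = lo<mid (interval k)

    half-⊆ : ∀ {k x} (d : Dec (Left k)) → Between (start d) (end d) x → x ∈ᴵ k
    half-⊆ {k} (yes _) (p , q) = <-trans (lo<mid (interval k)) p , q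
    half-⊆ {k} (no _)  (p , q) = p , <-trans q (mid<hi (interval k))

    not-split : ∀ {k l x y} → k <ₖ l → x ∈ᴵ l → y ∈ᴵ l → x < midpoint k → ¬ midpoint k < y
    not-split k<l (lo<x , _) (_ , y<hi) x<m m<y = midpoint-∉ k<l (<-trans lo<x x<m , <-trans m<y y<hi)

    -- In the `yes` case the intervals of l and l′ are nested, so x and y lie in a single interval
    -- later than k. Being convex, it would contain the midpoint of k.
    half-∌ : ∀ {k l x} (d : Dec (Left k)) → S l → k <ₖ l → x ∈ᴵ l → ¬ Between (start d) (end d) x
    half-∌ (no ¬left) Sl k<l x∈l (_ , x<m) = ¬left (_ , Sl , k<l , _ , x∈l , x<m)
    half-∌ (yes (l′ , Sl′ , k<l′ , y , y∈l′ , y<m)) Sl k<l x∈l (m<x , _) with chain Sl Sl′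
    ... | inj₁ (_ , l′⊆l)        = not-split k<l (l′⊆l y∈l′) x∈l y<m m<x
    ... | inj₂ (inj₁ refl)       = not-split k<l y∈l′ x∈l y<m m<x
    ... | inj₂ (inj₂ (_ , l⊆l′)) = not-split k<l′ y∈l′ (l⊆l′ x∈l) y<m m<x

    chain-countable : CountablyMany _≡_ S
    chain-countable = disjoint-countable S (λ k → start {k} em) (λ k → end {k} em)
      (λ k → start<end {k} em) λ {k} {l} Sk Sl x∈k x∈l →
        [ (λ k<l → ⊥-elim (half-∌ {k} em Sl k<l (half-⊆ {l} em x∈l) x∈k))
        , [ id , (λ l<k → ⊥-elim (half-∌ {l} em Sk l<k (half-⊆ {k} em x∈k) x∈l)) ]′ ]′ (<ₖ-compare k l)

  thin : ThinUncountable 𝕋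
  thin = record
    { chains      = Chain.chain-countable
    ; antichains  = antichain-countable
    ; uncountable = K-uncountable
    ; c           = id
    ; c-injective = id
    }

corollary3p8 :
    (∀ {ℓ} → ExcludedMiddle ℓ) →
    (∀ {a b} → Extensionality a b) →
    IGMP⟨ω₂⟩ →
    (¬ (∃[ 𝕋 ] Isω₁-Suslin 𝕋)) × SuslinHypothesis
corollary3p8 em ext igmp =
  (λ (𝕋 , suslin) → TreeForcing.IGMP-refuted em ext 𝕋 (SuslinTree.thin em ext 𝕋 suslin) igmp) ,
  (λ (L , suslin) → TreeForcing.IGMP-refuted em ext (SuslinLine.𝕋 em ext L suslin)
                                             (SuslinLine.thin em ext L suslin) igmp)
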